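{- Let $q \in (1,2)$ be a regular Pisot number and $q'$ a Galois conjugate of $q$. Then $|q'| \geq \frac{\sqrt5-1}{2}$.
   Context: A Pisot number is a real algebraic integer $q>1$ all of whose other Galois conjugates have absolute value strictly less than $1$. For integers $r \geq 1$ let $\Phi_r(x) = x^{r+1}-2x^r+x-1$, $\Psi_r(x) = x^{r+1}-x^r-\cdots-x-1$, and let $X(x) = x^4-x^3-2x^2+1$. Let $\phi_r$, $\psi_r$, $\chi$ be the roots in $(1,2)$ of $\Phi_r$, $\Psi_r$, $X$ respectively (these are the limit points of the Pisot numbers in $(1,2)$). For integers $r \geq 1$, $n \geq 1$ define $\Phi_{A,r,n}^{\pm}(x) = \Phi_r(x)x^n \pm (x^r-x^{r-1}+1)$, $\Phi_{B,r,n}^{\pm}(x) = \Phi_r(x)x^n \pm (x^r-x+1)$, $\Phi_{C,r,n}^{\pm}(x) = \Phi_r(x)x^n \pm (x^r+1)(x-1)$, $\Psi_{A,r,n}^{\pm}(x) = \Psi_r(x)x^n \pm (x^{r+1}-1)$, $\Psi_{B,r,n}^{\pm}(x) = \Psi_r(x)x^n \pm (x^r-1)/(x-1)$, $X_{A,n}^{\pm}(x) = X(x)x^n \pm (x^3+x^2-x-1)$, $X_{B,n}^{\pm}(x) = X(x)x^n \pm (x^4-x^2+1)$. A regular Pisot number in $(1,2)$ is either one of the numbers $\phi_r, \psi_r$ ($r\ge1$), $\chi$, or a Pisot number in $(1,2)$ which is a root of one of the polynomials $\Phi_{A,r,n}^{\pm},\Phi_{B,r,n}^{\pm},\Phi_{C,r,n}^{\pm},\Psi_{A,r,n}^{\pm},\Psi_{B,r,n}^{\pm},X_{A,n}^{\pm},X_{B,n}^{\pm}$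 (for some $r \ge 1$, $n\ge 1$). -}

module Defs where

open import Data.Nat.Base as ℕ using (ℕ; zero; suc)
import Data.Nat.Properties as ℕ
open import Data.Nat.Coprimality using (1-coprimeTo) renaming (sym to coprime-sym)
open import Data.Integer.Base as ℤ using (ℤ; +_; +[1+_]; -[1+_])
import Data.Integer.Properties as ℤ
open import Data.Rational.Base as ℚ using (ℚ; mkℚ; 0ℚ; 1ℚ; ½; ∣_∣; *≤*; *<*; ↥_; ↧ₙ_)
import Data.Rational.Properties as ℚ
open import Data.Rational.Solver using (module +-*-Solver)
open import Data.List.Base using (List; []; _∷_; _∷ʳ_; map; length; replicate)
open import Data.Product using (∃-syntax; _×_; _,_)
open import Data.Sign.Base using (Sign)
open import Data.Sum.Base using (_⊎_; inj₁; inj₂)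
open import Relation.Binary.PropositionalEquality
  using (_≡_; refl; sym; trans; cong; cong₂; subst)
open import Relation.Nullary using (¬_; yes; no)

open +-*-Solver using (solve; _:=_; _:+_; _:*_; _:-_; :-_; con)

------------------------------------------------------------------------
-- Auxiliary facts about ℚ

module ℚ-Facts where
  fromℕ : ℕ → ℚ
  fromℕ k = mkℚ (+ k) 0 (coprime-sym (1-coprimeTo k))

  1/suc : ℕ → ℚ
  1/suc n = mkℚ (+ 1) n (1-coprimeTo (suc n))

  half+half : ∀ ε → ½ ℚ.* ε ℚ.+ ½ ℚ.* ε ≡ ε
  half+half ε = trans (sym (ℚ.*-distribʳ-+ ε ½ ½)) (ℚ.*-identityˡ ε)

  0<* : ∀ {p q} → 0ℚ ℚ.< p → 0ℚ ℚ.< q → 0ℚ ℚ.< p ℚ.* q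
  0<* {p} {q} 0<p 0<q = subst (ℚ._< p ℚ.* q) (ℚ.*-zeroʳ p)
    (ℚ.*-monoʳ-<-pos p {{ℚ.positive 0<p}} 0<q)

  0≤* : ∀ {p q} → 0ℚ ℚ.≤ p → 0ℚ ℚ.≤ q → 0ℚ ℚ.≤ p ℚ.* q
  0≤* {p} {q} 0≤p 0≤q = subst (ℚ._≤ p ℚ.* q) (ℚ.*-zeroʳ p)
    (ℚ.*-monoˡ-≤-nonNeg p {{ℚ.nonNegative 0≤p}} 0≤q)

  0<½ : 0ℚ ℚ.< ½
  0<½ = ℚ.positive⁻¹ ½

  *-mono-≤ : ∀ {a b c d} → 0ℚ ℚ.≤ b → 0ℚ ℚ.≤ c → a ℚ.≤ b → c ℚ.≤ d → a ℚ.* c ℚ.≤ b ℚ.* d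
  *-mono-≤ {a} {b} {c} {d} 0≤b 0≤c a≤b c≤d = ℚ.≤-trans
    (ℚ.*-monoʳ-≤-nonNeg c {{ℚ.nonNegative 0≤c}} a≤b)
    (ℚ.*-monoˡ-≤-nonNeg b {{ℚ.nonNegative 0≤b}} c≤d)

  p≤p+q : ∀ {p q} → 0ℚ ℚ.≤ q → p ℚ.≤ p ℚ.+ q
  p≤p+q {p} {q} 0≤q = subst (ℚ._≤ p ℚ.+ q) (ℚ.+-identityʳ p) (ℚ.+-monoʳ-≤ p 0≤q)

  p<q+r⇒p-q<r : ∀ {p q r} → p ℚ.< q ℚ.+ r → p ℚ.- q ℚ.< r
  p<q+r⇒p-q<r {p} {q} {r} p<q+r = subst (p ℚ.- q ℚ.<_)
    (solve 2 (λ q r → q :+ r :- q := r) refl q r) (ℚ.+-monoˡ-< (ℚ.- q) p<q+r)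

  p-q<r⇒p<q+r : ∀ {p q r} → p ℚ.- q ℚ.< r → p ℚ.< q ℚ.+ r
  p-q<r⇒p<q+r {p} {q} {r} p-q<r = subst (ℚ._< q ℚ.+ r)
    (solve 2 (λ p q → q :+ (p :- q) := p) refl p q) (ℚ.+-monoʳ-< q p-q<r)

  p≤∣p∣ : ∀ p → p ℚ.≤ ∣ p ∣
  p≤∣p∣ p with ℚ.∣p∣≡p∨∣p∣≡-p p | ℚ.≤-total p 0ℚ
  ... | _ | inj₁ p≤0 = ℚ.≤-trans p≤0 (ℚ.0≤∣p∣ p)
  ... | _ | inj₂ 0≤p = ℚ.≤-reflexive (sym (ℚ.0≤p⇒∣p∣≡p 0≤p))

  -[p-q]≡q-p : ∀ p q → ℚ.- (p ℚ.- q) ≡ q ℚ.- p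
  -[p-q]≡q-p = solve 2 (λ p q → :- (p :- q) := q :- p) refl

  ∣p-q∣≡∣q-p∣ : ∀ p q → ∣ p ℚ.- q ∣ ≡ ∣ q ℚ.- p ∣
  ∣p-q∣≡∣q-p∣ p q = trans (sym (ℚ.∣-p∣≡∣p∣ (p ℚ.- q))) (cong ∣_∣ (-[p-q]≡q-p p q))

  close : ∀ {p q ε} → p ℚ.< q ℚ.+ ε → q ℚ.< p ℚ.+ ε → ∣ p ℚ.- q ∣ ℚ.< ε
  close {p} {q} {ε} p<q+ε q<p+ε with ℚ.∣p∣≡p∨∣p∣≡-p (p ℚ.- q)
  ... | inj₁ eq = subst (ℚ._< ε) (sym eq) (p<q+r⇒p-q<r p<q+ε)
  ... | inj₂ eq = subst (ℚ._< ε) (sym (trans eq (-[p-q]≡q-p p q))) (p<q+r⇒p-q<r q<p+ε)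

  divide : ∀ {b ε} → 0ℚ ℚ.< b → 0ℚ ℚ.< ε → ∃[ δ ] 0ℚ ℚ.< δ × b ℚ.* δ ≡ ε
  divide {b} {ε} 0<b 0<ε = ℚ.1/ b ℚ.* ε , 0<* (ℚ.positive⁻¹ (ℚ.1/ b)) 0<ε ,
    trans (sym (ℚ.*-assoc b (ℚ.1/ b) ε))
      (trans (cong (ℚ._* ε) (ℚ.*-inverseʳ b)) (ℚ.*-identityˡ ε))
    where
    instance
      b⁺ = ℚ.positive 0<b
      b≢0 = ℚ.pos⇒nonZero b
      b⁻¹ = ℚ.1/pos⇒pos b

open ℚ-Facts

------------------------------------------------------------------------
-- Real numbers: Cauchy sequences of rationals, with pointwise operations

IsCauchy : (ℕ → ℚ) → Set
IsCauchy x = ∀ ε → 0ℚ ℚ.< ε →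
  ∃[ N ] (∀ m n → N ℕ.≤ m → N ℕ.≤ n → ∣ x m ℚ.- x n ∣ ℚ.< ε)

record ℝ : Set where
  constructor mkℝ
  field
    seq    : ℕ → ℚ
    cauchy : IsCauchy seq

open ℝ public

infix 4 _≈ᴿ_ _<ᴿ_ _≤ᴿ_

_≈ᴿ_ : ℝ → ℝ → Set
x ≈ᴿ y = ∀ ε → 0ℚ ℚ.< ε → ∃[ N ] (∀ n → N ℕ.≤ n → ∣ seq x n ℚ.- seq y n ∣ ℚ.< ε)

_<ᴿ_ : ℝ → ℝ → Set
x <ᴿ y = ∃[ ε ] 0ℚ ℚ.< ε × ∃[ N ] (∀ n → N ℕ.≤ n → seq x n ℚ.+ ε ℚ.≤ seq y n)

_≤ᴿ_ : ℝ → ℝ → Set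
x ≤ᴿ y = ¬ (y <ᴿ x)

fromℚ : ℚ → ℝ
fromℚ p = mkℝ (λ _ → p) λ ε 0<ε → 0 , λ _ _ _ _ →
  subst (λ d → ∣ d ∣ ℚ.< ε) (sym (ℚ.+-inverseʳ p)) 0<ε

0ᴿ 1ᴿ : ℝ
0ᴿ = fromℚ 0ℚ
1ᴿ = fromℚ 1ℚ

module Cauchy-Facts where
  +-cauchy : ∀ x y → IsCauchy x → IsCauchy y → IsCauchy (λ n → x n ℚ.+ y n)
  +-cauchy x y cx cy ε 0<ε =
    let e          = ½ ℚ.* ε
        0<e        = 0<* 0<½ 0<ε
        (M , M-ok) = cx e 0<e
        (N , N-ok) = cy e 0<e
    in M ℕ.⊔ N , λ m n m≥ n≥ →
      let open ℚ.≤-Reasoning in begin-strict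
        ∣ (x m ℚ.+ y m) ℚ.- (x n ℚ.+ y n) ∣
          ≡⟨ cong ∣_∣ (solve 4 (λ a b c d → (a :+ b) :- (c :+ d) := (a :- c) :+ (b :- d))
               refl (x m) (y m) (x n) (y n)) ⟩
        ∣ (x m ℚ.- x n) ℚ.+ (y m ℚ.- y n) ∣
          ≤⟨ ℚ.∣p+q∣≤∣p∣+∣q∣ (x m ℚ.- x n) (y m ℚ.- y n) ⟩
        ∣ x m ℚ.- x n ∣ ℚ.+ ∣ y m ℚ.- y n ∣
          <⟨ ℚ.+-mono-< (M-ok m n (ℕ.m⊔n≤o⇒m≤o M N m≥) (ℕ.m⊔n≤o⇒m≤o M N n≥))
                        (N-ok m n (ℕ.m⊔n≤o⇒n≤o M N m≥) (ℕ.m⊔n≤o⇒n≤o M N n≥)) ⟩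
        e ℚ.+ e
          ≡⟨ half+half ε ⟩
        ε ∎

  neg-cauchy : ∀ x → IsCauchy x → IsCauchy (λ n → ℚ.- x n)
  neg-cauchy x cx ε 0<ε =
    let (N , N-ok) = cx ε 0<ε
    in N , λ m n m≥ n≥ → subst (ℚ._< ε)
      (trans (∣p-q∣≡∣q-p∣ (x m) (x n))
        (cong ∣_∣ (solve 2 (λ a b → b :- a := (:- a) :- (:- b)) refl (x m) (x n))))
      (N-ok m n m≥ n≥)

  eventually-bounded : ∀ x → IsCauchy x →
    ∃[ B ] 0ℚ ℚ.< B × ∃[ N ] (∀ n → N ℕ.≤ n → ∣ x n ∣ ℚ.≤ B)
  eventually-bounded x cx =
    let (N , N-ok) = cx 1ℚ (ℚ.positive⁻¹ 1ℚ)
    in ∣ x N ∣ ℚ.+ 1ℚ ,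
       ℚ.<-≤-trans (ℚ.positive⁻¹ 1ℚ)
         (subst (ℚ._≤ ∣ x N ∣ ℚ.+ 1ℚ) (ℚ.+-identityˡ 1ℚ) (ℚ.+-monoˡ-≤ 1ℚ (ℚ.0≤∣p∣ (x N)))) ,
       N , λ n n≥ → let open ℚ.≤-Reasoning in begin
         ∣ x n ∣
           ≡⟨ cong ∣_∣ (solve 2 (λ a b → a := b :+ (a :- b)) refl (x n) (x N)) ⟩
         ∣ x N ℚ.+ (x n ℚ.- x N) ∣
           ≤⟨ ℚ.∣p+q∣≤∣p∣+∣q∣ (x N) (x n ℚ.- x N) ⟩
         ∣ x N ∣ ℚ.+ ∣ x n ℚ.- x N ∣
           ≤⟨ ℚ.+-monoʳ-≤ ∣ x N ∣ (ℚ.<⇒≤ (N-ok n N n≥ ℕ.≤-refl)) ⟩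
         ∣ x N ∣ ℚ.+ 1ℚ ∎

  *-cauchy : ∀ x y → IsCauchy x → IsCauchy y → IsCauchy (λ n → x n ℚ.* y n)
  *-cauchy x y cx cy ε 0<ε =
    let (A , 0<A , K , K-ok) = eventually-bounded x cx
        (B , 0<B , L , L-ok) = eventually-bounded y cy
        (α , 0<α , Bα≡)      = divide 0<B (0<* 0<½ 0<ε)
        (β , 0<β , Aβ≡)      = divide 0<A (0<* 0<½ 0<ε)
        (M , M-ok)           = cx α 0<α
        (N , N-ok)           = cy β 0<β
        P                    = (K ℕ.⊔ L) ℕ.⊔ (M ℕ.⊔ N)
        ≥KL : ∀ {m} → P ℕ.≤ m → (K ℕ.⊔ L) ℕ.≤ m
        ≥KL = ℕ.m⊔n≤o⇒m≤o (K ℕ.⊔ L) (M ℕ.⊔ N)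
        ≥MN : ∀ {m} → P ℕ.≤ m → (M ℕ.⊔ N) ℕ.≤ m
        ≥MN = ℕ.m⊔n≤o⇒n≤o (K ℕ.⊔ L) (M ℕ.⊔ N)
    in P , λ m n m≥ n≥ →
      let open ℚ.≤-Reasoning
          dx = x m ℚ.- x n
          dy = y m ℚ.- y n
          ∣dx∣<α = M-ok m n (ℕ.m⊔n≤o⇒m≤o M N (≥MN m≥)) (ℕ.m⊔n≤o⇒m≤o M N (≥MN n≥))
          ∣dy∣<β = N-ok m n (ℕ.m⊔n≤o⇒n≤o M N (≥MN m≥)) (ℕ.m⊔n≤o⇒n≤o M N (≥MN n≥))
      in begin-strict
        ∣ x m ℚ.* y m ℚ.- x n ℚ.* y n ∣
          ≡⟨ cong ∣_∣ (solve 4 (λ a b c d → a :* b :- c :* d := a :* (b :- d) :+ d :* (a :- c))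
               refl (x m) (y m) (x n) (y n)) ⟩
        ∣ x m ℚ.* dy ℚ.+ y n ℚ.* dx ∣
          ≤⟨ ℚ.∣p+q∣≤∣p∣+∣q∣ (x m ℚ.* dy) (y n ℚ.* dx) ⟩
        ∣ x m ℚ.* dy ∣ ℚ.+ ∣ y n ℚ.* dx ∣
          ≡⟨ cong₂ ℚ._+_ (ℚ.∣p*q∣≡∣p∣*∣q∣ (x m) dy) (ℚ.∣p*q∣≡∣p∣*∣q∣ (y n) dx) ⟩
        ∣ x m ∣ ℚ.* ∣ dy ∣ ℚ.+ ∣ y n ∣ ℚ.* ∣ dx ∣
          ≤⟨ ℚ.+-mono-≤
               (ℚ.*-monoʳ-≤-nonNeg ∣ dy ∣ {{ℚ.∣-∣-nonNeg dy}} (K-ok m (ℕ.m⊔n≤o⇒m≤o K L (≥KL m≥))))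
               (ℚ.*-monoʳ-≤-nonNeg ∣ dx ∣ {{ℚ.∣-∣-nonNeg dx}} (L-ok n (ℕ.m⊔n≤o⇒n≤o K L (≥KL n≥)))) ⟩
        A ℚ.* ∣ dy ∣ ℚ.+ B ℚ.* ∣ dx ∣
          <⟨ ℚ.+-mono-< (ℚ.*-monoʳ-<-pos A {{ℚ.positive 0<A}} ∣dy∣<β)
                        (ℚ.*-monoʳ-<-pos B {{ℚ.positive 0<B}} ∣dx∣<α) ⟩
        A ℚ.* β ℚ.+ B ℚ.* α
          ≡⟨ cong₂ ℚ._+_ Aβ≡ Bα≡ ⟩
        ½ ℚ.* ε ℚ.+ ½ ℚ.* ε
          ≡⟨ half+half ε ⟩
        ε ∎

open Cauchy-Facts

infix  8 -ᴿ_
infixl 7 _*ᴿ_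
infixl 6 _+ᴿ_ _-ᴿ_

-ᴿ_ : ℝ → ℝ
-ᴿ x = mkℝ (λ n → ℚ.- seq x n) (neg-cauchy (seq x) (cauchy x))

_+ᴿ_ _*ᴿ_ _-ᴿ_ : ℝ → ℝ → ℝ
x +ᴿ y = mkℝ (λ n → seq x n ℚ.+ seq y n) (+-cauchy (seq x) (seq y) (cauchy x) (cauchy y))
x *ᴿ y = mkℝ (λ n → seq x n ℚ.* seq y n) (*-cauchy (seq x) (seq y) (cauchy x) (cauchy y))
x -ᴿ y = x +ᴿ (-ᴿ y)

------------------------------------------------------------------------
-- Square roots

-- The largest s in {s₀, s₀ + δ, …, s₀ + fuel·δ} such that every grid point
-- after s₀ and up to s has square at most a.

climb : (fuel : ℕ) (δ a s₀ : ℚ) → ℚ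
climb zero    δ a s = s
climb (suc k) δ a s with (s ℚ.+ δ) ℚ.* (s ℚ.+ δ) ℚ.≤? a
... | yes _ = climb k δ a (s ℚ.+ δ)
... | no  _ = s

-- For a ≥ 0, the largest multiple of 1/(n+1) whose square is at most a; for
-- a < 0 it is 0.  The fuel is large enough since a < (1 + ∣numerator of a∣)².

sqrtApprox : ℕ → ℚ → ℚ
sqrtApprox n a = climb (suc ℤ.∣ ↥ a ∣ ℕ.* suc n) (1/suc n) a 0ℚ

module Sqrt-Facts where
  fromℕ-+1 : ∀ k → fromℕ (suc k) ≡ fromℕ k ℚ.+ 1ℚ
  fromℕ-+1 k = sym (trans
    (cong (λ i → i ℚ./ 1) (trans (cong₂ ℤ._+_ (ℤ.*-identityʳ (+ k)) refl) (cong +_ (ℕ.+-comm k 1))))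
    (ℚ.↥p/↧p≡p (fromℕ (suc k))))

  fromℕ-* : ∀ k l → fromℕ (k ℕ.* l) ≡ fromℕ k ℚ.* fromℕ l
  fromℕ-* k l = sym (trans (cong (λ i → i ℚ./ 1) (sym (ℤ.pos-* k l))) (ℚ.↥p/↧p≡p (fromℕ (k ℕ.* l))))

  0≤fromℕ : ∀ k → 0ℚ ℚ.≤ fromℕ k
  0≤fromℕ k = ℚ.nonNegative⁻¹ (fromℕ k)

  0<1/suc : ∀ n → 0ℚ ℚ.< 1/suc n
  0<1/suc n = ℚ.positive⁻¹ (1/suc n)

  a≤∣num∣ : ∀ a → a ℚ.≤ fromℕ ℤ.∣ ↥ a ∣
  a≤∣num∣ (mkℚ (+ k) d _)    = *≤* (ℤ.*-monoˡ-≤-nonNeg (+ k) (ℤ.+≤+ (ℕ.s≤s ℕ.z≤n)))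
  a≤∣num∣ (mkℚ -[1+ k ] d _) = *≤* ℤ.-≤+

  1/suc-small : ∀ {ε} → 0ℚ ℚ.< ε → ∀ n → ↧ₙ ε ℕ.≤ n → 1/suc n ℚ.≤ ε
  1/suc-small {mkℚ (+ zero) d _}  (*<* (ℤ.+<+ ())) n d≤n
  1/suc-small {mkℚ +[1+ k ] d _}  0<ε n d≤n = *≤* (ℤ.+≤+
    (ℕ.≤-trans (ℕ.≤-reflexive (ℕ.*-identityˡ (suc d)))
      (ℕ.≤-trans d≤n (ℕ.≤-trans (ℕ.n≤1+n n) (ℕ.m≤m+n (suc n) (k ℕ.* suc n))))))
  1/suc-small {mkℚ -[1+ k ] d _}  (*<* ()) n d≤n

  square-mono : ∀ {p q} → 0ℚ ℚ.≤ p → p ℚ.≤ q → p ℚ.* p ℚ.≤ q ℚ.* q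
  square-mono 0≤p p≤q = *-mono-≤ (ℚ.≤-trans 0≤p p≤q) 0≤p p≤q p≤q

  record IsApprox (δ a s : ℚ) : Set where
    field
      nonNeg : 0ℚ ℚ.≤ s
      below  : s ≡ 0ℚ ⊎ s ℚ.* s ℚ.≤ a
      above  : a ℚ.< (s ℚ.+ δ) ℚ.* (s ℚ.+ δ)

  climb-approx : ∀ k {δ a s} → 0ℚ ℚ.≤ δ → 0ℚ ℚ.≤ s → s ≡ 0ℚ ⊎ s ℚ.* s ℚ.≤ a →
    (let t = s ℚ.+ fromℕ k ℚ.* δ ℚ.+ δ in a ℚ.< t ℚ.* t) → IsApprox δ a (climb k δ a s)
  climb-approx zero {δ} {a} {s} 0≤δ 0≤s below a<t² = record
    { nonNeg = 0≤s
    ; below  = below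
    ; above  = subst (λ t → a ℚ.< t ℚ.* t)
        (cong (ℚ._+ δ) (trans (cong (s ℚ.+_) (ℚ.*-zeroˡ δ)) (ℚ.+-identityʳ s))) a<t²
    }
  climb-approx (suc k) {δ} {a} {s} 0≤δ 0≤s below a<t²
    with (s ℚ.+ δ) ℚ.* (s ℚ.+ δ) ℚ.≤? a
  ... | yes s′²≤a = climb-approx k 0≤δ (ℚ.≤-trans 0≤s (p≤p+q 0≤δ)) (inj₂ s′²≤a)
    (subst (λ t → a ℚ.< t ℚ.* t)
      (trans (cong (λ c → s ℚ.+ c ℚ.* δ ℚ.+ δ) (fromℕ-+1 k))
        (solve 3 (λ s c d → s :+ (c :+ con 1ℚ) :* d :+ d := s :+ d :+ c :* d :+ d)
          refl s (fromℕ k) δ))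
      a<t²)
  ... | no  s′²≰a = record { nonNeg = 0≤s ; below = below ; above = ℚ.≰⇒> s′²≰a }

  fuel-enough : ∀ n a → (let t = 0ℚ ℚ.+ fromℕ (suc ℤ.∣ ↥ a ∣ ℕ.* suc n) ℚ.* 1/suc n ℚ.+ 1/suc n in
    a ℚ.< t ℚ.* t)
  fuel-enough n a = begin-strict
    a                  ≤⟨ a≤∣num∣ a ⟩
    c                  ≡⟨ ℚ.+-identityʳ c ⟨
    c ℚ.+ 0ℚ           <⟨ ℚ.+-monoʳ-< c (ℚ.positive⁻¹ 1ℚ) ⟩
    c ℚ.+ 1ℚ           ≤⟨ p≤p+q (ℚ.≤-trans (0≤* (0≤fromℕ k) (0≤fromℕ k)) (p≤p+q (0≤fromℕ k))) ⟩
    c ℚ.+ 1ℚ ℚ.+ (c ℚ.* c ℚ.+ c)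
                       ≡⟨ solve 1 (λ c → c :+ con 1ℚ :+ (c :* c :+ c)
                            := (c :+ con 1ℚ) :* (c :+ con 1ℚ)) refl c ⟩
    (c ℚ.+ 1ℚ) ℚ.* (c ℚ.+ 1ℚ)
                       ≤⟨ square-mono (ℚ.≤-trans (0≤fromℕ k) (p≤p+q (ℚ.<⇒≤ (ℚ.positive⁻¹ 1ℚ)))) c+1≤t ⟩
    t ℚ.* t            ∎
    where
    open ℚ.≤-Reasoning
    k = ℤ.∣ ↥ a ∣
    c = fromℕ k
    t = 0ℚ ℚ.+ fromℕ (suc k ℕ.* suc n) ℚ.* 1/suc n ℚ.+ 1/suc n
    c+1≤t : c ℚ.+ 1ℚ ℚ.≤ t
    c+1≤t = begin
      c ℚ.+ 1ℚ                                        ≡⟨ fromℕ-+1 k ⟨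
      fromℕ (suc k)                                   ≡⟨ ℚ.*-identityʳ (fromℕ (suc k)) ⟨
      fromℕ (suc k) ℚ.* 1ℚ                            ≡⟨ cong (fromℕ (suc k) ℚ.*_) (ℚ.*-inverseʳ (fromℕ (suc n))) ⟨
      fromℕ (suc k) ℚ.* (fromℕ (suc n) ℚ.* 1/suc n)   ≡⟨ ℚ.*-assoc (fromℕ (suc k)) (fromℕ (suc n)) (1/suc n) ⟨
      fromℕ (suc k) ℚ.* fromℕ (suc n) ℚ.* 1/suc n     ≡⟨ cong (ℚ._* 1/suc n) (fromℕ-* (suc k) (suc n)) ⟨
      fromℕ (suc k ℕ.* suc n) ℚ.* 1/suc n             ≡⟨ ℚ.+-identityˡ _ ⟨
      0ℚ ℚ.+ fromℕ (suc k ℕ.* suc n) ℚ.* 1/suc n      ≤⟨ p≤p+q (ℚ.<⇒≤ (0<1/suc n)) ⟩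
      t                                               ∎

  sqrtApprox-approx : ∀ n a → IsApprox (1/suc n) a (sqrtApprox n a)
  sqrtApprox-approx n a = climb-approx (suc ℤ.∣ ↥ a ∣ ℕ.* suc n)
    (ℚ.<⇒≤ (0<1/suc n)) ℚ.≤-refl (inj₁ refl) (fuel-enough n a)

  approx-close : ∀ {e δ δ′ a b s t} → 0ℚ ℚ.< e → δ′ ℚ.≤ e → 0ℚ ℚ.≤ δ′ →
    IsApprox δ a s → IsApprox δ′ b t → ∣ a ℚ.- b ∣ ℚ.< e ℚ.* e → s ℚ.< t ℚ.+ (e ℚ.+ e)
  approx-close {e} {δ} {δ′} {a} {b} {s} {t} 0<e δ′≤e 0≤δ′ A B ∣a-b∣<e² =
    ℚ.≰⇒> λ t+2e≤s → case-below t+2e≤s (IsApprox.below A)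
    where
    open ℚ.≤-Reasoning
    0≤t = IsApprox.nonNeg B
    0≤e = ℚ.<⇒≤ 0<e
    0<t+2e : 0ℚ ℚ.< t ℚ.+ (e ℚ.+ e)
    0<t+2e = ℚ.+-mono-≤-< 0≤t (ℚ.+-mono-< 0<e 0<e)
    0≤t+e : 0ℚ ℚ.≤ t ℚ.+ e
    0≤t+e = ℚ.+-mono-≤ 0≤t 0≤e
    case-below : t ℚ.+ (e ℚ.+ e) ℚ.≤ s → ¬ (s ≡ 0ℚ ⊎ s ℚ.* s ℚ.≤ a)
    case-below t+2e≤s (inj₁ s≡0)  =
      ℚ.<-irrefl refl (ℚ.<-≤-trans 0<t+2e (subst (t ℚ.+ (e ℚ.+ e) ℚ.≤_) s≡0 t+2e≤s))
    case-below t+2e≤s (inj₂ s²≤a) = ℚ.<-irrefl refl (begin-strict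
      a
        <⟨ p-q<r⇒p<q+r (ℚ.≤-<-trans (p≤∣p∣ (a ℚ.- b)) ∣a-b∣<e²) ⟩
      b ℚ.+ e ℚ.* e
        ≤⟨ ℚ.+-monoˡ-≤ (e ℚ.* e) (ℚ.<⇒≤ (IsApprox.above B)) ⟩
      (t ℚ.+ δ′) ℚ.* (t ℚ.+ δ′) ℚ.+ e ℚ.* e
        ≤⟨ ℚ.+-monoˡ-≤ (e ℚ.* e) (square-mono (ℚ.+-mono-≤ 0≤t 0≤δ′) (ℚ.+-monoʳ-≤ t δ′≤e)) ⟩
      (t ℚ.+ e) ℚ.* (t ℚ.+ e) ℚ.+ e ℚ.* e
        ≤⟨ p≤p+q (ℚ.+-mono-≤ (0≤* 0≤t+e 0≤e) (0≤* 0≤t+e 0≤e)) ⟩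
      (t ℚ.+ e) ℚ.* (t ℚ.+ e) ℚ.+ e ℚ.* e ℚ.+ ((t ℚ.+ e) ℚ.* e ℚ.+ (t ℚ.+ e) ℚ.* e)
        ≡⟨ solve 2 (λ t e → (t :+ e) :* (t :+ e) :+ e :* e :+ ((t :+ e) :* e :+ (t :+ e) :* e)
             := (t :+ (e :+ e)) :* (t :+ (e :+ e))) refl t e ⟩
      (t ℚ.+ (e ℚ.+ e)) ℚ.* (t ℚ.+ (e ℚ.+ e))
        ≤⟨ square-mono (ℚ.<⇒≤ 0<t+2e) t+2e≤s ⟩
      s ℚ.* s
        ≤⟨ s²≤a ⟩
      a ∎)

  √-cauchy : ∀ x → IsCauchy x → IsCauchy (λ n → sqrtApprox n (x n))
  √-cauchy x cx ε 0<ε =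
    let e          = ½ ℚ.* ε
        0<e        = 0<* 0<½ 0<ε
        (N , N-ok) = cx (e ℚ.* e) (0<* 0<e 0<e)
        one-sided  = λ m n m≥ n≥ → subst (λ z → sqrtApprox m (x m) ℚ.< sqrtApprox n (x n) ℚ.+ z)
          (half+half ε)
          (approx-close 0<e (1/suc-small 0<e n (ℕ.m⊔n≤o⇒n≤o N (↧ₙ e) n≥)) (ℚ.<⇒≤ (0<1/suc n))
            (sqrtApprox-approx m (x m)) (sqrtApprox-approx n (x n))
            (N-ok m n (ℕ.m⊔n≤o⇒m≤o N (↧ₙ e) m≥) (ℕ.m⊔n≤o⇒m≤o N (↧ₙ e) n≥)))
    in N ℕ.⊔ ↧ₙ e , λ m n m≥ n≥ → close (one-sided m n m≥ n≥) (one-sided n m n≥ m≥)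

open Sqrt-Facts

-- The nonnegative square root of max(x, 0).

infix 9 √_

√_ : ℝ → ℝ
√ x = mkℝ (λ n → sqrtApprox n (seq x n)) (√-cauchy (seq x) (cauchy x))

------------------------------------------------------------------------
-- Complex numbers

record ℂ : Set where
  constructor _+i_
  field
    re im : ℝ

open ℂ public

infix  4 _≈ᶜ_
infixl 7 _*ᶜ_
infixl 6 _+ᶜ_

_≈ᶜ_ : ℂ → ℂ → Set
z ≈ᶜ w = re z ≈ᴿ re w × im z ≈ᴿ im w

fromℝ : ℝ → ℂ
fromℝ x = x +i 0ᴿ

0ᶜ : ℂ
0ᶜ = fromℝ 0ᴿ

_+ᶜ_ _*ᶜ_ : ℂ → ℂ → ℂ
z +ᶜ w = (re z +ᴿ re w) +i (im z +ᴿ im w)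
z *ᶜ w = (re z *ᴿ re w -ᴿ im z *ᴿ im w) +i (re z *ᴿ im w +ᴿ im z *ᴿ re w)

∥_∥ : ℂ → ℝ
∥ z ∥ = √ (re z *ᴿ re z +ᴿ im z *ᴿ im z)

------------------------------------------------------------------------
-- Polynomials, as lists of coefficients starting from the constant term

ℤ[x] ℚ[x] : Set
ℤ[x] = List ℤ
ℚ[x] = List ℚ

ℤ⇒ℚ : ℤ[x] → ℚ[x]
ℤ⇒ℚ = map (λ c → c ℚ./ 1)

eval : ℚ[x] → ℂ → ℂ
eval []      z = 0ᶜ
eval (c ∷ p) z = fromℝ (fromℚ c) +ᶜ z *ᶜ eval p z

IsRoot : ℚ[x] → ℂ → Set
IsRoot p z = eval p z ≈ᶜ 0ᶜ

Monic : ℚ[x] → Set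
Monic p = ∃[ cs ] p ≡ cs ∷ʳ 1ℚ

infix  8 -ₚ_
infixl 7 _*ₚ_
infixl 6 _+ₚ_ _-ₚ_

-ₚ_ : ℤ[x] → ℤ[x]
-ₚ p = map ℤ.-_ p

_+ₚ_ _*ₚ_ _-ₚ_ : ℤ[x] → ℤ[x] → ℤ[x]
[]      +ₚ q       = q
(a ∷ p) +ₚ []      = a ∷ p
(a ∷ p) +ₚ (b ∷ q) = (a ℤ.+ b) ∷ (p +ₚ q)

[]      *ₚ q = []
(a ∷ p) *ₚ q = map (a ℤ.*_) q +ₚ (ℤ.0ℤ ∷ p *ₚ q)

p -ₚ q = p +ₚ (-ₚ q)

const : ℤ → ℤ[x]
const c = c ∷ []

x^_ : ℕ → ℤ[x]
x^ n = replicate n ℤ.0ℤ ∷ʳ ℤ.1ℤ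

-- 1 + x + ⋯ + x^(k-1), which is also the quotient (x^k - 1)/(x - 1).

geometric : ℕ → ℤ[x]
geometric k = replicate k ℤ.1ℤ

------------------------------------------------------------------------
-- Galois conjugates and Pisot numbers

AlgebraicInteger : ℝ → Set
AlgebraicInteger q = ∃[ p ] Monic (ℤ⇒ℚ p) × IsRoot (ℤ⇒ℚ p) (fromℝ q)

-- The monic polynomial over ℚ of least degree having q as a root.  A monic
-- coefficient list has no trailing zeros, so its length is its degree plus 1.

IsMinimalPolynomial : ℚ[x] → ℝ → Set
IsMinimalPolynomial p q = Monic p × IsRoot p (fromℝ q) ×
  (∀ r → Monic r → IsRoot r (fromℝ q) → length p ℕ.≤ length r)

GaloisConjugate : ℝ → ℂ → Set
GaloisConjugate q z = ∃[ p ] IsMinimalPolynomial p q × IsRoot p z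

Pisot : ℝ → Set
Pisot q = AlgebraicInteger q × 1ᴿ <ᴿ q ×
  (∀ z → GaloisConjugate q z → ¬ (z ≈ᶜ fromℝ q) → ∥ z ∥ <ᴿ 1ᴿ)

------------------------------------------------------------------------
-- Regular Pisot numbers in (1,2)

Φ Ψ : ℕ → ℤ[x]
Φ r = x^ (suc r) -ₚ const (+ 2) *ₚ x^ r +ₚ x^ 1 -ₚ const (+ 1)
Ψ r = x^ (suc r) -ₚ geometric (suc r)

Χ : ℤ[x]
Χ = x^ 4 -ₚ x^ 3 -ₚ const (+ 2) *ₚ x^ 2 +ₚ const (+ 1)

_±[_]_ : ℤ[x] → Sign → ℤ[x] → ℤ[x]
p ±[ Sign.+ ] q = p +ₚ q
p ±[ Sign.- ] q = p -ₚ q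

infixl 6 _±[_]_

data LimitPolynomial : ℤ[x] → Set where
  Φ-limit : ∀ {r} → 1 ℕ.≤ r → LimitPolynomial (Φ r)
  Ψ-limit : ∀ {r} → 1 ℕ.≤ r → LimitPolynomial (Ψ r)
  Χ-limit : LimitPolynomial Χ

data RegularPolynomial : ℤ[x] → Set where
  Φ-A : ∀ {r n} s → 1 ℕ.≤ r → 1 ℕ.≤ n →
        RegularPolynomial (Φ r *ₚ x^ n ±[ s ] (x^ r -ₚ x^ (r ℕ.∸ 1) +ₚ const (+ 1)))
  Φ-B : ∀ {r n} s → 1 ℕ.≤ r → 1 ℕ.≤ n →
        RegularPolynomial (Φ r *ₚ x^ n ±[ s ] (x^ r -ₚ x^ 1 +ₚ const (+ 1)))
  Φ-C : ∀ {r n} s → 1 ℕ.≤ r → 1 ℕ.≤ n →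
        RegularPolynomial (Φ r *ₚ x^ n ±[ s ] ((x^ r +ₚ const (+ 1)) *ₚ (x^ 1 -ₚ const (+ 1))))
  Ψ-A : ∀ {r n} s → 1 ℕ.≤ r → 1 ℕ.≤ n →
        RegularPolynomial (Ψ r *ₚ x^ n ±[ s ] (x^ (suc r) -ₚ const (+ 1)))
  Ψ-B : ∀ {r n} s → 1 ℕ.≤ r → 1 ℕ.≤ n →
        RegularPolynomial (Ψ r *ₚ x^ n ±[ s ] geometric r)
  Χ-A : ∀ {n} s → 1 ℕ.≤ n →
        RegularPolynomial (Χ *ₚ x^ n ±[ s ] (x^ 3 +ₚ x^ 2 -ₚ x^ 1 -ₚ const (+ 1)))
  Χ-B : ∀ {n} s → 1 ℕ.≤ n →
        RegularPolynomial (Χ *ₚ x^ n ±[ s ] (x^ 4 -ₚ x^ 2 +ₚ const (+ 1)))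

-- The numbers φᵣ, ψᵣ, χ are the roots in (1,2) of the limit polynomials.

RegularPisotIn⟨1,2⟩ : ℝ → Set
RegularPisotIn⟨1,2⟩ q = 1ᴿ <ᴿ q × q <ᴿ fromℚ (+ 2 ℚ./ 1) ×
  ( (∃[ p ] LimitPolynomial p × IsRoot (ℤ⇒ℚ p) (fromℝ q))
  ⊎ (Pisot q × ∃[ p ] RegularPolynomial p × IsRoot (ℤ⇒ℚ p) (fromℝ q)) )

{-# OPTIONS --safe #-}
module Submission where

-- If q′ is a conjugate of q, every rational polynomial vanishing at q vanishes at q′, so it suffices to
-- find a polynomial with root q and without roots in the disc ∣z∣ < (√5 - 1)/2.  Usually the polynomial P
-- defining q will do.  It has the form p₀ + w p₁ + v (p₂ + w p₃) with w = xⁱ, v = ± xʲ and small fixed pₖ,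
-- where p₀ has constant term ±1.  Multiplied by a truncation u of the power series of ± 1/p₀, it has a
-- constant term exceeding the sum of the absolute values of all other terms on a slightly larger disc,
-- as long as ∣w∣, ∣v∣ ≤ 1; this is checked by computation.
--
-- The exceptions are the multiples of x² - x - 1, for which the cofactor is treated in this way; some
-- families with n ≤ 2, whose roots in the disc are harmless because P has no root in (1,2), as its
-- expansion in powers of x - 1 and 2 - x shows; and Φ_{A,1,n}, which is divisible by x.
--
-- Real and complex numbers are Cauchy sequences, so all of this is carried out termwise over ℚ[i],
-- where a root gives rise to a null sequence.

open import Defs
open import Data.Integer.Base using (+_)
open import Data.Rational.Base using (½; _/_)

open import Algebra.Bundles using (CommutativeRing)
import Algebra.Solver.Ring as RingSolver
open import Algebra.Solver.Ring.AlmostCommutativeRing using (fromCommutativeRing; _-Raw-AlmostCommutative⟶_)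
open import Algebra.Structures using (IsCommutativeRing)
open import Data.Empty using (⊥; ⊥-elim)
open import Data.Integer.Base as ℤ using (ℤ)
import Data.Integer.Properties as ℤ
open import Data.List.Base using (List; []; _∷_; _∷ʳ_; map; length; take; initLast; _∷ʳ′_)
open import Data.List.Properties using (length-map; length-++)
open import Data.List.Relation.Unary.All using (All; []; _∷_; all?)
open import Data.Maybe.Base using (just; nothing)
open import Data.Nat.Base as ℕ using (ℕ; zero; suc; _≤_; s≤s)
import Data.Nat.Properties as ℕ
open import Data.Product using (_×_; _,_; proj₁; proj₂; ∃-syntax)
open import Data.Rational.Base as ℚ using (ℚ; 0ℚ; 1ℚ; ∣_∣; ↧ₙ_)
import Data.Rational.Properties as ℚ
open import Data.Rational.Solver using (module +-*-Solver)
import Data.Rational.Unnormalised.Base as ℚᵘ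
import Data.Rational.Unnormalised.Properties as ℚᵘ
open import Data.Sign.Base using (Sign)
open import Data.Sum.Base using (_⊎_; inj₁; inj₂)
open import Data.Unit.Base using (⊤)
open import Level using (0ℓ)
open import Relation.Binary.Definitions using (WeaklyDecidable)
open import Relation.Binary.PropositionalEquality
open import Relation.Nullary using (¬_; yes; no)
open import Relation.Nullary.Decidable using (True; toWitness)
open ℚ-Facts

-- Evaluation of integer polynomials

module Evaluation
  {A : Set} (_⊕_ _⊗_ : A → A → A) (⊖_ : A → A) (0# 1# : A)
  (isCommutativeRing : IsCommutativeRing _≡_ _⊕_ _⊗_ ⊖_ 0# 1#)
  (ι : ℤ → A)
  (ι-+ : ∀ a b → ι (a ℤ.+ b) ≡ ι a ⊕ ι b)
  (ι-* : ∀ a b → ι (a ℤ.* b) ≡ ι a ⊗ ι b)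
  (ι-neg : ∀ a → ι (ℤ.- a) ≡ ⊖ ι a)
  (ι-0 : ι ℤ.0ℤ ≡ 0#)
  (ι-1 : ι ℤ.1ℤ ≡ 1#)
  where

  infixl 7 _*_
  infixl 6 _+_ _-_

  _+_ _*_ _-_ : A → A → A
  _+_ = _⊕_
  _*_ = _⊗_
  x - y = x + (⊖ y)

  private
    ring : CommutativeRing 0ℓ 0ℓ
    ring = record { isCommutativeRing = isCommutativeRing }

    ι-morphism : ℤ.+-*-rawRing -Raw-AlmostCommutative⟶ fromCommutativeRing ring
    ι-morphism = record
      { ⟦_⟧ = ι ; +-homo = ι-+ ; *-homo = ι-* ; -‿homo = ι-neg ; 0-homo = ι-0 ; 1-homo = ι-1 }

    ≟-weak : WeaklyDecidable (λ a b → ι a ≡ ι b)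
    ≟-weak a b with a ℤ.≟ b
    ... | yes a≡b = just (cong ι a≡b)
    ... | no  _   = nothing

  -- Constants of the solver are integers, entering through `ι`, while the ring stays abstract; so
  -- no identity proved here unfolds into rational arithmetic.
  module Solver = RingSolver ℤ.+-*-rawRing (fromCommutativeRing ring) ι-morphism ≟-weak
  open Solver using (solve; _:=_; _:+_; _:*_; _:-_; :-_; con)
  open IsCommutativeRing isCommutativeRing using (+-identityˡ; +-identityʳ; *-identityˡ; *-identityʳ; zeroˡ)

  ⟦_⟧ : ℤ[x] → A → A
  ⟦ [] ⟧    z = 0#
  ⟦ c ∷ p ⟧ z = ι c + z * ⟦ p ⟧ z

  power : A → ℕ → A
  power z zero    = 1#
  power z (suc n) = z * power z n

  power-+ : ∀ z m n → power z (m ℕ.+ n) ≡ power z m * power z n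
  power-+ z zero    n = sym (*-identityˡ _)
  power-+ z (suc m) n = trans (cong (z *_) (power-+ z m n))
    (solve 3 (λ z a b → z :* (a :* b) := z :* a :* b) refl z (power z m) (power z n))

  eval-+ : ∀ p q z → ⟦ p +ₚ q ⟧ z ≡ ⟦ p ⟧ z + ⟦ q ⟧ z
  eval-+ []      q       z = sym (+-identityˡ _)
  eval-+ (a ∷ p) []      z = sym (+-identityʳ _)
  eval-+ (a ∷ p) (b ∷ q) z = trans (cong₂ (λ u v → u + z * v) (ι-+ a b) (eval-+ p q z))
    (solve 5 (λ a b z p q → a :+ b :+ z :* (p :+ q) := a :+ z :* p :+ (b :+ z :* q)) refl
      (ι a) (ι b) z (⟦ p ⟧ z) (⟦ q ⟧ z))

  eval-neg : ∀ p z → ⟦ -ₚ p ⟧ z ≡ ⊖ ⟦ p ⟧ z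
  eval-neg []   z = trans (sym ι-0) (trans (ι-neg ℤ.0ℤ) (cong ⊖_ ι-0))
  eval-neg (a ∷ p) z = trans (cong₂ (λ u v → u + z * v) (ι-neg a) (eval-neg p z))
    (solve 3 (λ a z p → :- a :+ z :* :- p := :- (a :+ z :* p)) refl (ι a) z (⟦ p ⟧ z))

  eval-- : ∀ p q z → ⟦ p -ₚ q ⟧ z ≡ ⟦ p ⟧ z - ⟦ q ⟧ z
  eval-- p q z = trans (eval-+ p (-ₚ q) z) (cong (λ u → ⟦ p ⟧ z + u) (eval-neg q z))

  eval-scale : ∀ a p z → ⟦ map (a ℤ.*_) p ⟧ z ≡ ι a * ⟦ p ⟧ z
  eval-scale a []      z = sym (IsCommutativeRing.zeroʳ isCommutativeRing _)
  eval-scale a (c ∷ p) z = trans (cong₂ (λ u v → u + z * v) (ι-* a c) (eval-scale a p z))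
    (solve 4 (λ a c z p → a :* c :+ z :* (a :* p) := a :* (c :+ z :* p)) refl (ι a) (ι c) z (⟦ p ⟧ z))

  eval-* : ∀ p q z → ⟦ p *ₚ q ⟧ z ≡ ⟦ p ⟧ z * ⟦ q ⟧ z
  eval-* []      q z = sym (zeroˡ _)
  eval-* (a ∷ p) q z = trans (eval-+ (map (a ℤ.*_) q) _ z)
    (trans (cong₂ _+_ (eval-scale a q z) (cong₂ (λ u v → u + z * v) ι-0 (eval-* p q z)))
      (trans (cong (λ u → ι a * ⟦ q ⟧ z + (u + z * (⟦ p ⟧ z * ⟦ q ⟧ z))) (sym ι-0))
      (solve 4 (λ a z p q → a :* q :+ (con ℤ.0ℤ :+ z :* (p :* q)) := (a :+ z :* p) :* q) refl
        (ι a) z (⟦ p ⟧ z) (⟦ q ⟧ z))))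

  eval-const : ∀ c z → ⟦ const c ⟧ z ≡ ι c
  eval-const c z = trans (cong (λ u → ι c + z * u) (sym ι-0))
    (solve 2 (λ c z → c :+ z :* con ℤ.0ℤ := c) refl (ι c) z)

  eval-x^ : ∀ n z → ⟦ x^ n ⟧ z ≡ power z n
  eval-x^ zero    z = trans (eval-const ℤ.1ℤ z) ι-1
  eval-x^ (suc n) z = trans (cong₂ (λ u v → u + z * v) ι-0 (eval-x^ n z)) (+-identityˡ _)

  eval-x : ∀ z → ⟦ x^ 1 ⟧ z ≡ z
  eval-x z = trans (eval-x^ 1 z) (*-identityʳ z)

  geometric-sum : ∀ n z → (z - 1#) * ⟦ geometric n ⟧ z ≡ power z n - 1#
  geometric-sum zero    z = trans (cong₂ (λ u v → (z - u) * v) (sym ι-1) (sym ι-0))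
    (trans (solve 1 (λ z → (z :- con ℤ.1ℤ) :* con ℤ.0ℤ := con ℤ.1ℤ :- con ℤ.1ℤ) refl z) (cong₂ _-_ ι-1 ι-1))
  geometric-sum (suc n) z = begin
    -- The solver knows the unit only as the constant ι 1, so the ring's own unit is traded for it
    -- and later traded back.
    (z - 1#) * (ι ℤ.1ℤ + z * g)         ≡⟨ cong (λ u → (z - u) * (ι ℤ.1ℤ + z * g)) (sym ι-1) ⟩
    (z - ι ℤ.1ℤ) * (ι ℤ.1ℤ + z * g)     ≡⟨ solve 2 (λ z g → (z :- con ℤ.1ℤ) :* (con ℤ.1ℤ :+ z :* g)
                                             := z :* ((z :- con ℤ.1ℤ) :* g) :+ (z :- con ℤ.1ℤ)) refl z g ⟩
    z * ((z - ι ℤ.1ℤ) * g) + (z - ι ℤ.1ℤ) ≡⟨ cong (λ u → z * ((z - u) * g) + (z - u)) ι-1 ⟩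
    z * ((z - 1#) * g) + (z - 1#)       ≡⟨ cong (λ u → z * u + (z - 1#)) (geometric-sum n z) ⟩
    z * (power z n - 1#) + (z - 1#)     ≡⟨ solve 3 (λ z w o → z :* (w :- o) :+ (z :- o)
                                             := z :* w :+ (z :- z :* o) :- o) refl z (power z n) 1# ⟩
    z * power z n + (z - z * 1#) - 1#   ≡⟨ cong (λ u → z * power z n + (z - u) - 1#) (*-identityʳ z) ⟩
    z * power z n + (z - z) - 1#        ≡⟨ solve 3 (λ z w o → w :+ (z :- z) :- o := w :- o) refl z (z * power z n) 1# ⟩
    z * power z n - 1#                  ∎
    where
    open ≡-Reasoning
    g = ⟦ geometric n ⟧ z

  -- Syntax for polynomials, needed because ⟦ p ⟧ z does not determine p for unification.

  data Expr : Set where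
    var       : Expr
    cst       : ℤ → Expr
    var^_     : ℕ → Expr
    var^[_+_] : ℕ → ℕ → Expr
    _⊞_ _⊟_ _⊠_ : Expr → Expr → Expr

  infixl 6 _⊞_ _⊟_
  infixl 7 _⊠_
  infix  9 var^_

  polynomial : Expr → ℤ[x]
  polynomial var           = x^ 1
  polynomial (cst c)       = const c
  polynomial (var^ n)      = x^ n
  polynomial var^[ m + n ] = x^ (m ℕ.+ n)
  polynomial (e ⊞ f)     = polynomial e +ₚ polynomial f
  polynomial (e ⊟ f)     = polynomial e -ₚ polynomial f
  polynomial (e ⊠ f)     = polynomial e *ₚ polynomial f

  value : Expr → A → A
  value var           z = z
  value (cst c)       z = ι c
  value (var^ n)      z = power z n
  value var^[ m + n ] z = power z m * power z n
  value (e ⊞ f)     z = value e z + value f z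
  value (e ⊟ f)     z = value e z - value f z
  value (e ⊠ f)     z = value e z * value f z

  eval-expr : ∀ e z → ⟦ polynomial e ⟧ z ≡ value e z
  eval-expr var           z = eval-x z
  eval-expr (cst c)       z = eval-const c z
  eval-expr (var^ n)      z = eval-x^ n z
  eval-expr var^[ m + n ] z = trans (eval-x^ (m ℕ.+ n) z) (power-+ z m n)
  eval-expr (e ⊞ f)     z = trans (eval-+ (polynomial e) (polynomial f) z) (cong₂ _+_ (eval-expr e z) (eval-expr f z))
  eval-expr (e ⊟ f)     z = trans (eval-- (polynomial e) (polynomial f) z) (cong₂ _-_ (eval-expr e z) (eval-expr f z))
  eval-expr (e ⊠ f)     z = trans (eval-* (polynomial e) (polynomial f) z) (cong₂ _*_ (eval-expr e z) (eval-expr f z))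

  -- A polynomial f depending on r = R + i, described by polynomials f₀, f₁ which do not depend on i.
  -- The multiplier m is x - 1 for the families built from Ψᵣ, to sum their geometric series.

  record Split (m : ℤ[x]) (i : ℕ) (f f₀ f₁ : ℤ[x]) : Set where
    constructor split
    field
      identity : ∀ z → ⟦ m ⟧ z * ⟦ f ⟧ z ≡ ⟦ f₀ ⟧ z + power z i * ⟦ f₁ ⟧ z

  open Split public

  one x-1 : ℤ[x]
  one = const (+ 1)
  x-1 = x^ 1 -ₚ const (+ 1)

  -- A single polynomial counts as a family with f₁ = 0, so that fixed and variable exponents share
  -- the same criteria.
  split-trivial : ∀ f → Split one 0 f f []
  split-trivial f = split λ z → trans (cong (_* ⟦ f ⟧ z) (eval-const (+ 1) z)) (trans (cong₂ _*_ ι-1 refl)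
    (trans (*-identityˡ _) (sym (trans (cong (λ u → ⟦ f ⟧ z + u) (IsCommutativeRing.zeroʳ isCommutativeRing _)) (+-identityʳ _)))))

  split-expr : ∀ i m e e₀ e₁ → (∀ z → value m z * value e z ≡ value e₀ z + power z i * value e₁ z) →
    Split (polynomial m) i (polynomial e) (polynomial e₀) (polynomial e₁)
  split-expr i m e e₀ e₁ eq = split λ z → trans (cong₂ _*_ (eval-expr m z) (eval-expr e z))
    (trans (eq z) (sym (cong₂ (λ a b → a + power z i * b) (eval-expr e₀ z) (eval-expr e₁ z))))

  private
    unit var-1 : Expr
    unit   = cst (+ 1)
    var-1 = var ⊟ cst (+ 1)

  -- Here x^(r+1) - 2x^r = x^r (x - 2). The fixed part x^R of x^r stays with the second polynomial,
  -- which it makes small on the disc.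
  Φ-split : ∀ R i → Split one i (Φ (R ℕ.+ i)) x-1 (x^ R *ₚ (x^ 1 -ₚ const (+ 2)))
  Φ-split R i = split-expr i unit (var^[ suc R + i ] ⊟ cst (+ 2) ⊠ var^[ R + i ] ⊞ var ⊟ cst (+ 1)) (var-1) (var^ R ⊠ (var ⊟ cst (+ 2)))
    (λ z → solve 3 (λ z w v → con (+ 1) :* (z :* w :* v :- con (+ 2) :* (w :* v) :+ z :- con (+ 1))
      := z :- con (+ 1) :+ v :* (w :* (z :- con (+ 2)))) refl z (power z R) (power z i))

  -- The index is r = R + 1 + i, one more than elsewhere, so that `r ∸ 1` reduces to R + i.
  Φ-A-split : ∀ R i → Split one i (x^ (suc R ℕ.+ i) -ₚ x^ (R ℕ.+ i) +ₚ const (+ 1)) one (x^ R *ₚ x-1)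
  Φ-A-split R i = split-expr i unit (var^[ suc R + i ] ⊟ var^[ R + i ] ⊞ cst (+ 1)) (unit) (var^ R ⊠ var-1)
    (λ z → solve 3 (λ z w v → con (+ 1) :* (z :* w :* v :- w :* v :+ con (+ 1))
      := con (+ 1) :+ v :* (w :* (z :- con (+ 1)))) refl z (power z R) (power z i))

  Φ-B-split : ∀ R i → Split one i (x^ (R ℕ.+ i) -ₚ x^ 1 +ₚ const (+ 1)) (const (+ 1) -ₚ x^ 1) (x^ R)
  Φ-B-split R i = split-expr i unit (var^[ R + i ] ⊟ var ⊞ cst (+ 1)) (cst (+ 1) ⊟ var) (var^ R)
    (λ z → solve 3 (λ z w v → con (+ 1) :* (w :* v :- z :+ con (+ 1))
      := con (+ 1) :- z :+ v :* w) refl z (power z R) (power z i))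

  Φ-C-split : ∀ R i → Split one i ((x^ (R ℕ.+ i) +ₚ const (+ 1)) *ₚ x-1) x-1 (x^ R *ₚ x-1)
  Φ-C-split R i = split-expr i unit ((var^[ R + i ] ⊞ cst (+ 1)) ⊠ var-1) (var-1) (var^ R ⊠ var-1)
    (λ z → solve 3 (λ z w v → con (+ 1) :* ((w :* v :+ con (+ 1)) :* (z :- con (+ 1)))
      := z :- con (+ 1) :+ v :* (w :* (z :- con (+ 1)))) refl z (power z R) (power z i))

  -- There is no series to sum; the multiplier x - 1 is the one that `Ψ-split` has, as `split-±`
  -- requires.
  Ψ-A-split : ∀ R i → Split x-1 i (x^ (suc R ℕ.+ i) -ₚ const (+ 1)) (const (+ 1) -ₚ x^ 1) (x^ (suc R) *ₚ x-1)
  Ψ-A-split R i = split-expr i var-1 (var^[ suc R + i ] ⊟ cst (+ 1)) (cst (+ 1) ⊟ var) (var^ (suc R) ⊠ var-1)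
    (λ z → solve 3 (λ z w v → (z :- con (+ 1)) :* (z :* w :* v :- con (+ 1))
      := con (+ 1) :- z :+ v :* (z :* w :* (z :- con (+ 1)))) refl z (power z R) (power z i))

  Ψ-B-split : ∀ R i → Split x-1 i (geometric (R ℕ.+ i)) (const (ℤ.- (+ 1))) (x^ R)
  Ψ-B-split R i = split λ z → begin
    ⟦ x-1 ⟧ z * ⟦ geometric (R ℕ.+ i) ⟧ z
      ≡⟨ cong (_* ⟦ geometric (R ℕ.+ i) ⟧ z) (trans (eval-expr var-1 z) (cong (z -_) ι-1)) ⟩
    (z - 1#) * ⟦ geometric (R ℕ.+ i) ⟧ z
      ≡⟨ geometric-sum (R ℕ.+ i) z ⟩
    power z (R ℕ.+ i) - 1#
      ≡⟨ cong₂ _-_ (power-+ z R i) (sym ι-1) ⟩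
    power z R * power z i - ι (+ 1)
      ≡⟨ solve 2 (λ w v → w :* v :- con (+ 1) := con (ℤ.- (+ 1)) :+ v :* w) refl (power z R) (power z i) ⟩
    ι (ℤ.- (+ 1)) + power z i * power z R
      ≡⟨ cong₂ (λ a b → a + power z i * b) (eval-const (ℤ.- (+ 1)) z) (eval-x^ R z) ⟨
    ⟦ const (ℤ.- (+ 1)) ⟧ z + power z i * ⟦ x^ R ⟧ z ∎
    where open ≡-Reasoning

  -- Summing the geometric series gives (x - 1) Ψᵣ = x^(r+2) - 2x^(r+1) + 1.
  Ψ-split : ∀ R i → Split x-1 i (Ψ (R ℕ.+ i)) one (x^ (suc R) *ₚ (x^ 1 -ₚ const (+ 2)))
  Ψ-split R i = split λ z → let g = ⟦ geometric (suc R ℕ.+ i) ⟧ z in begin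
    ⟦ x-1 ⟧ z * ⟦ Ψ (R ℕ.+ i) ⟧ z
      ≡⟨ cong₂ _*_ (eval-expr var-1 z) (trans (eval-- (x^ (suc R ℕ.+ i)) (geometric (suc R ℕ.+ i)) z)
           (cong (_- g) (eval-expr var^[ suc R + i ] z))) ⟩
    (z - ι (+ 1)) * (z * power z R * power z i - g)
      ≡⟨ solve 4 (λ z w v g → (z :- con (+ 1)) :* (z :* w :* v :- g)
           := (z :- con (+ 1)) :* (z :* w :* v) :- (z :- con (+ 1)) :* g) refl z (power z R) (power z i) g ⟩
    (z - ι (+ 1)) * (z * power z R * power z i) - (z - ι (+ 1)) * g
      ≡⟨ cong (λ u → (z - ι (+ 1)) * (z * power z R * power z i) - u)
           (trans (cong (λ u → (z - u) * g) ι-1) (trans (geometric-sum (suc R ℕ.+ i) z) (cong₂ _-_ (power-+ z (suc R) i) (sym ι-1)))) ⟩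
    (z - ι (+ 1)) * (z * power z R * power z i) - (z * power z R * power z i - ι (+ 1))
      ≡⟨ solve 3 (λ z w v → (z :- con (+ 1)) :* (z :* w :* v) :- (z :* w :* v :- con (+ 1))
           := con (+ 1) :+ v :* (z :* w :* (z :- con (+ 2)))) refl z (power z R) (power z i) ⟩
    ι (+ 1) + power z i * (z * power z R * (z - ι (+ 2)))
      ≡⟨ cong₂ (λ a b → a + power z i * b) (eval-expr unit z) (eval-expr (var^ (suc R) ⊠ (var ⊟ cst (+ 2))) z) ⟨
    ⟦ one ⟧ z + power z i * ⟦ x^ (suc R) *ₚ (x^ 1 -ₚ const (+ 2)) ⟧ z ∎
    where open ≡-Reasoning

  signed : Sign → A → A
  signed Sign.+ z = z
  signed Sign.- z = ⊖ z

  eval-± : ∀ s p q z → ⟦ p ±[ s ] q ⟧ z ≡ ⟦ p ⟧ z + signed s (⟦ q ⟧ z)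
  eval-± Sign.+ p q z = eval-+ p q z
  eval-± Sign.- p q z = eval-- p q z

  module _ {m i f f₀ f₁ g g₀ g₁} (f-split : Split m i f f₀ f₁) (g-split : Split m i g g₀ g₁) where

    expand-± : ∀ n s z → ⟦ m ⟧ z * ⟦ f *ₚ x^ n ±[ s ] g ⟧ z
      ≡ (⟦ f₀ ⟧ z + power z i * ⟦ f₁ ⟧ z) * ⟦ x^ n ⟧ z + signed s (⟦ g₀ ⟧ z + power z i * ⟦ g₁ ⟧ z)
    expand-± n s z = trans
      (cong (⟦ m ⟧ z *_) (trans (eval-± s (f *ₚ x^ n) g z) (cong (_+ signed s (⟦ g ⟧ z)) (eval-* f (x^ n) z))))
      (trans (distribute s) (cong₂ (λ a b → a * ⟦ x^ n ⟧ z + signed s b) (identity f-split z) (identity g-split z)))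
      where
      distribute : ∀ s → ⟦ m ⟧ z * (⟦ f ⟧ z * ⟦ x^ n ⟧ z + signed s (⟦ g ⟧ z))
        ≡ ⟦ m ⟧ z * ⟦ f ⟧ z * ⟦ x^ n ⟧ z + signed s (⟦ m ⟧ z * ⟦ g ⟧ z)
      distribute Sign.+ = solve 4 (λ m f y g → m :* (f :* y :+ g) := m :* f :* y :+ m :* g) refl
        (⟦ m ⟧ z) (⟦ f ⟧ z) (⟦ x^ n ⟧ z) (⟦ g ⟧ z)
      distribute Sign.- = solve 4 (λ m f y g → m :* (f :* y :- g) := m :* f :* y :- m :* g) refl
        (⟦ m ⟧ z) (⟦ f ⟧ z) (⟦ x^ n ⟧ z) (⟦ g ⟧ z)

    -- For one particular n: xⁿ is absorbed into the fixed polynomials, and only the exponent i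
    -- remains variable.
    split-± : ∀ n s → Split m i (f *ₚ x^ n ±[ s ] g) (f₀ *ₚ x^ n ±[ s ] g₀) (f₁ *ₚ x^ n ±[ s ] g₁)
    split-± n s = split λ z → trans (expand-± n s z) (trans (collect z s) (sym (cong₂ (λ a b → a + power z i * b)
      (trans (eval-± s (f₀ *ₚ x^ n) g₀ z) (cong (_+ signed s (⟦ g₀ ⟧ z)) (eval-* f₀ (x^ n) z)))
      (trans (eval-± s (f₁ *ₚ x^ n) g₁ z) (cong (_+ signed s (⟦ g₁ ⟧ z)) (eval-* f₁ (x^ n) z))))))
      where
      collect : ∀ z s → (⟦ f₀ ⟧ z + power z i * ⟦ f₁ ⟧ z) * ⟦ x^ n ⟧ z + signed s (⟦ g₀ ⟧ z + power z i * ⟦ g₁ ⟧ z)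
        ≡ ⟦ f₀ ⟧ z * ⟦ x^ n ⟧ z + signed s (⟦ g₀ ⟧ z) + power z i * (⟦ f₁ ⟧ z * ⟦ x^ n ⟧ z + signed s (⟦ g₁ ⟧ z))
      collect z Sign.+ = solve 6 (λ f₀ f₁ g₀ g₁ w y → (f₀ :+ w :* f₁) :* y :+ (g₀ :+ w :* g₁)
        := f₀ :* y :+ g₀ :+ w :* (f₁ :* y :+ g₁)) refl
        (⟦ f₀ ⟧ z) (⟦ f₁ ⟧ z) (⟦ g₀ ⟧ z) (⟦ g₁ ⟧ z) (power z i) (⟦ x^ n ⟧ z)
      collect z Sign.- = solve 6 (λ f₀ f₁ g₀ g₁ w y → (f₀ :+ w :* f₁) :* y :- (g₀ :+ w :* g₁)
        := f₀ :* y :- g₀ :+ w :* (f₁ :* y :- g₁)) refl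
        (⟦ f₀ ⟧ z) (⟦ f₁ ⟧ z) (⟦ g₀ ⟧ z) (⟦ g₁ ⟧ z) (power z i) (⟦ x^ n ⟧ z)

    -- The sign is moved to the factor xʲ, which only matters through its absolute value;
    -- so one certificate serves both signs.

    signed-expand-± : ∀ N j s z → signed s (⟦ m ⟧ z * ⟦ f *ₚ x^ (N ℕ.+ j) ±[ s ] g ⟧ z)
      ≡ ⟦ g₀ ⟧ z + power z i * ⟦ g₁ ⟧ z + signed s (power z j) * (⟦ f₀ *ₚ x^ N ⟧ z + power z i * ⟦ f₁ *ₚ x^ N ⟧ z)
    signed-expand-± N j s z = trans (cong (signed s) (expand-± (N ℕ.+ j) s z))
      (trans (cong (λ y → signed s ((⟦ f₀ ⟧ z + power z i * ⟦ f₁ ⟧ z) * y + signed s (⟦ g₀ ⟧ z + power z i * ⟦ g₁ ⟧ z)))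
               (trans (eval-expr var^[ N + j ] z) (cong (_* power z j) (sym (eval-x^ N z)))))
      (trans (collect s) (sym (cong₂ (λ a b → ⟦ g₀ ⟧ z + power z i * ⟦ g₁ ⟧ z + signed s (power z j) * (a + power z i * b))
        (eval-* f₀ (x^ N) z) (eval-* f₁ (x^ N) z)))))
      where
      collect : ∀ s → signed s ((⟦ f₀ ⟧ z + power z i * ⟦ f₁ ⟧ z) * (⟦ x^ N ⟧ z * power z j)
            + signed s (⟦ g₀ ⟧ z + power z i * ⟦ g₁ ⟧ z))
        ≡ ⟦ g₀ ⟧ z + power z i * ⟦ g₁ ⟧ z
          + signed s (power z j) * (⟦ f₀ ⟧ z * ⟦ x^ N ⟧ z + power z i * (⟦ f₁ ⟧ z * ⟦ x^ N ⟧ z))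
      collect Sign.+ = solve 6 (λ f₀ f₁ g w y v → (f₀ :+ w :* f₁) :* (y :* v) :+ g
        := g :+ v :* (f₀ :* y :+ w :* (f₁ :* y))) refl
        (⟦ f₀ ⟧ z) (⟦ f₁ ⟧ z) (⟦ g₀ ⟧ z + power z i * ⟦ g₁ ⟧ z) (power z i) (⟦ x^ N ⟧ z) (power z j)
      collect Sign.- = solve 6 (λ f₀ f₁ g w y v → :- ((f₀ :+ w :* f₁) :* (y :* v) :- g)
        := g :+ :- v :* (f₀ :* y :+ w :* (f₁ :* y))) refl
        (⟦ f₀ ⟧ z) (⟦ f₁ ⟧ z) (⟦ g₀ ⟧ z + power z i * ⟦ g₁ ⟧ z) (power z i) (⟦ x^ N ⟧ z) (power z j)

-- The embedding of the integers into the rationals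

/1-+ : ∀ a b → (a ℤ.+ b) ℚ./ 1 ≡ a ℚ./ 1 ℚ.+ b ℚ./ 1
/1-+ a b = ℚ.toℚᵘ-injective (begin
  ℚ.toℚᵘ ((a ℤ.+ b) ℚ./ 1)                         ≈⟨ ℚ.toℚᵘ-fromℚᵘ _ ⟩
  ℚᵘ.mkℚᵘ (a ℤ.+ b) 0                              ≈⟨ ℚᵘ.*≡* (cong (ℤ._* ℤ.1ℤ) (sym (cong₂ ℤ._+_ (ℤ.*-identityʳ a) (ℤ.*-identityʳ b)))) ⟩
  ℚᵘ.mkℚᵘ a 0 ℚᵘ.+ ℚᵘ.mkℚᵘ b 0                     ≈⟨ ℚᵘ.+-cong (ℚ.toℚᵘ-fromℚᵘ (ℚᵘ.mkℚᵘ a 0)) (ℚ.toℚᵘ-fromℚᵘ (ℚᵘ.mkℚᵘ b 0)) ⟨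
  ℚ.toℚᵘ (a ℚ./ 1) ℚᵘ.+ ℚ.toℚᵘ (b ℚ./ 1)           ≈⟨ ℚ.toℚᵘ-homo-+ (a ℚ./ 1) (b ℚ./ 1) ⟨
  ℚ.toℚᵘ (a ℚ./ 1 ℚ.+ b ℚ./ 1)                     ∎)
  where open ℚᵘ.≃-Reasoning

/1-* : ∀ a b → (a ℤ.* b) ℚ./ 1 ≡ (a ℚ./ 1) ℚ.* (b ℚ./ 1)
/1-* a b = ℚ.toℚᵘ-injective (begin
  ℚ.toℚᵘ ((a ℤ.* b) ℚ./ 1)                         ≈⟨ ℚ.toℚᵘ-fromℚᵘ _ ⟩
  ℚᵘ.mkℚᵘ a 0 ℚᵘ.* ℚᵘ.mkℚᵘ b 0                     ≈⟨ ℚᵘ.*-cong (ℚ.toℚᵘ-fromℚᵘ (ℚᵘ.mkℚᵘ a 0)) (ℚ.toℚᵘ-fromℚᵘ (ℚᵘ.mkℚᵘ b 0)) ⟨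
  ℚ.toℚᵘ (a ℚ./ 1) ℚᵘ.* ℚ.toℚᵘ (b ℚ./ 1)           ≈⟨ ℚ.toℚᵘ-homo-* (a ℚ./ 1) (b ℚ./ 1) ⟨
  ℚ.toℚᵘ ((a ℚ./ 1) ℚ.* (b ℚ./ 1))                 ∎)
  where open ℚᵘ.≃-Reasoning

/1-neg : ∀ a → (ℤ.- a) ℚ./ 1 ≡ ℚ.- (a ℚ./ 1)
/1-neg a = ℚ.toℚᵘ-injective (begin
  ℚ.toℚᵘ ((ℤ.- a) ℚ./ 1)    ≈⟨ ℚ.toℚᵘ-fromℚᵘ _ ⟩
  ℚᵘ.- ℚᵘ.mkℚᵘ a 0          ≈⟨ ℚᵘ.-‿cong (ℚ.toℚᵘ-fromℚᵘ (ℚᵘ.mkℚᵘ a 0)) ⟨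
  ℚᵘ.- ℚ.toℚᵘ (a ℚ./ 1)     ≈⟨ ℚ.toℚᵘ-homo‿- (a ℚ./ 1) ⟨
  ℚ.toℚᵘ (ℚ.- (a ℚ./ 1))    ∎)
  where open ℚᵘ.≃-Reasoning

-- Gaussian rationals

ℚ[i] : Set
ℚ[i] = ℚ × ℚ

infixl 7 _·_
infixl 6 _⊕_
infix  8 ⊖_

_⊕_ _·_ : ℚ[i] → ℚ[i] → ℚ[i]
(a , b) ⊕ (c , d) = a ℚ.+ c , b ℚ.+ d
(a , b) · (c , d) = a ℚ.* c ℚ.- b ℚ.* d , a ℚ.* d ℚ.+ b ℚ.* c

⊖_ : ℚ[i] → ℚ[i]
⊖ (a , b) = ℚ.- a , ℚ.- b

real : ℚ → ℚ[i]
real a = a , 0ℚ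

ι : ℤ → ℚ[i]
ι c = real (c ℚ./ 1)

module _ where
  open +-*-Solver using (solve; _:=_; _:+_; _:*_; _:-_; :-_; con)

  ⊕-·-isCommutativeRing : IsCommutativeRing _≡_ _⊕_ _·_ ⊖_ (real 0ℚ) (real 1ℚ)
  ⊕-·-isCommutativeRing = record
    { isRing = record
      { +-isAbelianGroup = record
        { isGroup = record
          { isMonoid = record
            { isSemigroup = record
              { isMagma = record { isEquivalence = isEquivalence ; ∙-cong = cong₂ _⊕_ }
              ; assoc = λ (a , b) (c , d) (e , f) → cong₂ _,_ (ℚ.+-assoc a c e) (ℚ.+-assoc b d f)
              }
            ; identity = (λ _ → cong₂ _,_ (ℚ.+-identityˡ _) (ℚ.+-identityˡ _))
                       , (λ _ → cong₂ _,_ (ℚ.+-identityʳ _) (ℚ.+-identityʳ _))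
            }
          ; inverse = (λ (a , b) → cong₂ _,_ (ℚ.+-inverseˡ a) (ℚ.+-inverseˡ b))
                    , (λ (a , b) → cong₂ _,_ (ℚ.+-inverseʳ a) (ℚ.+-inverseʳ b))
          ; ⁻¹-cong = cong ⊖_
          }
        ; comm = λ (a , b) (c , d) → cong₂ _,_ (ℚ.+-comm a c) (ℚ.+-comm b d)
        }
      ; *-cong = cong₂ _·_
      ; *-assoc = λ (a , b) (c , d) (e , f) → cong₂ _,_
          (solve 6 (λ a b c d e f → (a :* c :- b :* d) :* e :- (a :* d :+ b :* c) :* f
            := a :* (c :* e :- d :* f) :- b :* (c :* f :+ d :* e)) refl a b c d e f)
          (solve 6 (λ a b c d e f → (a :* c :- b :* d) :* f :+ (a :* d :+ b :* c) :* e
            := a :* (c :* f :+ d :* e) :+ b :* (c :* e :- d :* f)) refl a b c d e f)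
      ; *-identity =
          (λ (a , b) → cong₂ _,_
            (solve 2 (λ a b → con 1ℚ :* a :- con 0ℚ :* b := a) refl a b)
            (solve 2 (λ a b → con 1ℚ :* b :+ con 0ℚ :* a := b) refl a b))
        , (λ (a , b) → cong₂ _,_
            (solve 2 (λ a b → a :* con 1ℚ :- b :* con 0ℚ := a) refl a b)
            (solve 2 (λ a b → a :* con 0ℚ :+ b :* con 1ℚ := b) refl a b))
      ; distrib =
          (λ (a , b) (c , d) (e , f) → cong₂ _,_
            (solve 6 (λ a b c d e f → a :* (c :+ e) :- b :* (d :+ f)
              := a :* c :- b :* d :+ (a :* e :- b :* f)) refl a b c d e f)
            (solve 6 (λ a b c d e f → a :* (d :+ f) :+ b :* (c :+ e)
              := a :* d :+ b :* c :+ (a :* f :+ b :* e)) refl a b c d e f))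
        , (λ (a , b) (c , d) (e , f) → cong₂ _,_
            (solve 6 (λ a b c d e f → (c :+ e) :* a :- (d :+ f) :* b
              := c :* a :- d :* b :+ (e :* a :- f :* b)) refl a b c d e f)
            (solve 6 (λ a b c d e f → (c :+ e) :* b :+ (d :+ f) :* a
              := c :* b :+ d :* a :+ (e :* b :+ f :* a)) refl a b c d e f))
      }
    ; *-comm = λ (a , b) (c , d) → cong₂ _,_
        (solve 4 (λ a b c d → a :* c :- b :* d := c :* a :- d :* b) refl a b c d)
        (solve 4 (λ a b c d → a :* d :+ b :* c := c :* b :+ d :* a) refl a b c d)
    }

  real-· : ∀ a b → real (a ℚ.* b) ≡ real a · real b
  real-· a b = cong₂ _,_
    (solve 2 (λ a b → a :* b := a :* b :- con 0ℚ :* con 0ℚ) refl a b)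
    (solve 2 (λ a b → con 0ℚ := a :* con 0ℚ :+ con 0ℚ :* b) refl a b)

ι-+ : ∀ a b → ι (a ℤ.+ b) ≡ ι a ⊕ ι b
ι-+ a b = cong real (/1-+ a b)

ι-* : ∀ a b → ι (a ℤ.* b) ≡ ι a · ι b
ι-* a b = trans (cong real (/1-* a b)) (real-· (a ℚ./ 1) (b ℚ./ 1))

ι-neg : ∀ a → ι (ℤ.- a) ≡ ⊖ ι a
ι-neg a = cong real (/1-neg a)

open Evaluation _⊕_ _·_ ⊖_ (real 0ℚ) (real 1ℚ) ⊕-·-isCommutativeRing ι ι-+ ι-* ι-neg refl refl
  hiding (_+_; _*_; _-_)

at : ℂ → ℕ → ℚ[i]
at z n = seq (re z) n , seq (im z) n

evalAt : ℚ[x] → ℚ[i] → ℚ[i]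
evalAt []      z = real 0ℚ
evalAt (c ∷ p) z = real c ⊕ z · evalAt p z

-- The operations on real and complex numbers act term by term, so evaluation commutes with taking
-- the nth term by computation.
at-eval : ∀ p z n → at (eval p z) n ≡ evalAt p (at z n)
at-eval []      z n = refl
at-eval (c ∷ p) z n = cong (λ w → real c ⊕ at z n · w) (at-eval p z n)

evalAt-ℤ⇒ℚ : ∀ p z → evalAt (ℤ⇒ℚ p) z ≡ ⟦ p ⟧ z
evalAt-ℤ⇒ℚ []      z = refl
evalAt-ℤ⇒ℚ (c ∷ p) z = cong (λ w → ι c ⊕ z · w) (evalAt-ℤ⇒ℚ p z)

-- Squared absolute values

square-cancel-≤ : ∀ {p q} → 0ℚ ℚ.≤ q → p ℚ.* p ℚ.≤ q ℚ.* q → p ℚ.≤ q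
square-cancel-≤ {p} {q} 0≤q p²≤q² = ℚ.≮⇒≥ λ q<p → ℚ.<-irrefl refl (begin-strict
  q ℚ.* q ≤⟨ *-mono-≤ 0≤q 0≤q ℚ.≤-refl (ℚ.<⇒≤ q<p) ⟩
  q ℚ.* p <⟨ ℚ.*-monoˡ-<-pos p {{ℚ.positive (ℚ.≤-<-trans 0≤q q<p)}} q<p ⟩
  p ℚ.* p ≤⟨ p²≤q² ⟩
  q ℚ.* q ∎)
  where open ℚ.≤-Reasoning

0≤square : ∀ p → 0ℚ ℚ.≤ p ℚ.* p
0≤square p = subst (0ℚ ℚ.≤_) (trans (sym (ℚ.∣p*q∣≡∣p∣*∣q∣ p p)) ∣p²∣≡p²) (0≤* (ℚ.0≤∣p∣ p) (ℚ.0≤∣p∣ p))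
  where
  ∣p²∣≡p² : ∣ p ℚ.* p ∣ ≡ p ℚ.* p
  ∣p²∣≡p² with ℚ.∣p∣≡p∨∣p∣≡-p p
  ... | inj₁ ∣p∣≡p  = trans (ℚ.∣p*q∣≡∣p∣*∣q∣ p p) (cong₂ ℚ._*_ ∣p∣≡p ∣p∣≡p)
  ... | inj₂ ∣p∣≡-p = trans (ℚ.∣p*q∣≡∣p∣*∣q∣ p p) (trans (cong₂ ℚ._*_ ∣p∣≡-p ∣p∣≡-p)
    (solve 1 (λ p → :- p :* :- p := p :* p) refl p))
    where open +-*-Solver using (solve; _:=_; _:*_; :-_)

∣p∣²≡p² : ∀ p → ∣ p ∣ ℚ.* ∣ p ∣ ≡ p ℚ.* p
∣p∣²≡p² p = trans (sym (ℚ.∣p*q∣≡∣p∣*∣q∣ p p)) (ℚ.0≤p⇒∣p∣≡p (0≤square p))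

norm : ℚ[i] → ℚ
norm (a , b) = a ℚ.* a ℚ.+ b ℚ.* b

0≤norm : ∀ z → 0ℚ ℚ.≤ norm z
0≤norm (a , b) = ℚ.+-mono-≤ (0≤square a) (0≤square b)

-- ∣ z ∣ ≤ b, in terms of squares since ∣ z ∣ need not be rational.

record Bound (z : ℚ[i]) (b : ℚ) : Set where
  constructor _,_
  field
    nonNeg : 0ℚ ℚ.≤ b
    norm≤  : norm z ℚ.≤ b ℚ.* b

module _ where
  open +-*-Solver using (solve; _:=_; _:+_; _:*_; _:-_; :-_; con)

  norm-· : ∀ z w → norm (z · w) ≡ norm z ℚ.* norm w
  norm-· (a , b) (c , d) = solve 4 (λ a b c d →
    (a :* c :- b :* d) :* (a :* c :- b :* d) :+ (a :* d :+ b :* c) :* (a :* d :+ b :* c)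
      := (a :* a :+ b :* b) :* (c :* c :+ d :* d)) refl a b c d

  bound-· : ∀ {z w b c} → Bound z b → Bound w c → Bound (z · w) (b ℚ.* c)
  bound-· {z} {w} {b} {c} (0≤b , z≤b) (0≤c , w≤c) = 0≤* 0≤b 0≤c , (begin
    norm (z · w)                   ≡⟨ norm-· z w ⟩
    norm z ℚ.* norm w              ≤⟨ *-mono-≤ (0≤* 0≤b 0≤b) (0≤norm w) z≤b w≤c ⟩
    b ℚ.* b ℚ.* (c ℚ.* c)          ≡⟨ solve 2 (λ b c → b :* b :* (c :* c) := b :* c :* (b :* c)) refl b c ⟩
    b ℚ.* c ℚ.* (b ℚ.* c)          ∎)
    where open ℚ.≤-Reasoning

  -- The triangle inequality without square roots: the squared norm of the sum is expanded, and its
  -- cross term is bounded by the Cauchy-Schwarz inequality.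
  bound-⊕ : ∀ {z w b c} → Bound z b → Bound w c → Bound (z ⊕ w) (b ℚ.+ c)
  bound-⊕ {z@(x , y)} {w@(x′ , y′)} {b} {c} (0≤b , z≤b) (0≤c , w≤c) = ℚ.+-mono-≤ 0≤b 0≤c , (begin
    norm (z ⊕ w)
      ≡⟨ solve 4 (λ x y x′ y′ → (x :+ x′) :* (x :+ x′) :+ (y :+ y′) :* (y :+ y′)
           := x :* x :+ y :* y :+ (x′ :* x′ :+ y′ :* y′) :+ (x :* x′ :+ y :* y′ :+ (x :* x′ :+ y :* y′))) refl x y x′ y′ ⟩
    norm z ℚ.+ norm w ℚ.+ (dot ℚ.+ dot)
      ≤⟨ ℚ.+-mono-≤ (ℚ.+-mono-≤ z≤b w≤c) (ℚ.+-mono-≤ dot≤bc dot≤bc) ⟩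
    b ℚ.* b ℚ.+ c ℚ.* c ℚ.+ (b ℚ.* c ℚ.+ b ℚ.* c)
      ≡⟨ solve 2 (λ b c → b :* b :+ c :* c :+ (b :* c :+ b :* c) := (b :+ c) :* (b :+ c)) refl b c ⟩
    (b ℚ.+ c) ℚ.* (b ℚ.+ c) ∎)
    where
    open ℚ.≤-Reasoning
    dot = x ℚ.* x′ ℚ.+ y ℚ.* y′
    det = x ℚ.* y′ ℚ.- y ℚ.* x′
    -- By Lagrange's identity, dot² + det² is the product of the two norms.
    dot≤bc : dot ℚ.≤ b ℚ.* c
    dot≤bc = square-cancel-≤ (0≤* 0≤b 0≤c) (begin
      dot ℚ.* dot                     ≤⟨ p≤p+q (0≤square det) ⟩
      dot ℚ.* dot ℚ.+ det ℚ.* det     ≡⟨ solve 4 (λ x y x′ y′ →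
        (x :* x′ :+ y :* y′) :* (x :* x′ :+ y :* y′) :+ (x :* y′ :- y :* x′) :* (x :* y′ :- y :* x′)
          := (x :* x :+ y :* y) :* (x′ :* x′ :+ y′ :* y′)) refl x y x′ y′ ⟩
      norm z ℚ.* norm w               ≤⟨ *-mono-≤ (0≤* 0≤b 0≤b) (0≤norm w) z≤b w≤c ⟩
      b ℚ.* b ℚ.* (c ℚ.* c)           ≡⟨ solve 2 (λ b c → b :* b :* (c :* c) := b :* c :* (b :* c)) refl b c ⟩
      b ℚ.* c ℚ.* (b ℚ.* c)           ∎)

  norm-real : ∀ a → norm (real a) ≡ a ℚ.* a
  norm-real = solve 1 (λ a → a :* a :+ con 0ℚ :* con 0ℚ := a :* a) refl

  bound-neg : ∀ {z b} → Bound z b → Bound (⊖ z) b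
  bound-neg {x , y} {b} (0≤b , z≤b) = 0≤b ,
    subst (ℚ._≤ b ℚ.* b) (solve 2 (λ x y → x :* x :+ y :* y := :- x :* :- x :+ :- y :* :- y) refl x y) z≤b

bound-real : ∀ a → Bound (real a) ∣ a ∣
bound-real a = ℚ.0≤∣p∣ a , ℚ.≤-reflexive (trans (norm-real a) (sym (∣p∣²≡p² a)))

bound-real⁻¹ : ∀ {a b} → Bound (real a) b → ∣ a ∣ ℚ.≤ b
bound-real⁻¹ {a} {b} (0≤b , a≤b) = square-cancel-≤ 0≤b
  (subst (ℚ._≤ b ℚ.* b) (trans (norm-real a) (sym (∣p∣²≡p² a))) a≤b)

bound-weaken : ∀ {z b c} → b ℚ.≤ c → Bound z b → Bound z c
bound-weaken b≤c (0≤b , z≤b) = ℚ.≤-trans 0≤b b≤c , ℚ.≤-trans z≤b (*-mono-≤ (ℚ.≤-trans 0≤b b≤c) 0≤b b≤c b≤c)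

bound-power : ∀ {z b} n → b ℚ.≤ 1ℚ → Bound z b → Bound (power z n) 1ℚ
bound-power zero    b≤1 z≤b = bound-real 1ℚ
bound-power (suc n) b≤1 z≤b = bound-· (bound-weaken b≤1 z≤b) (bound-power n b≤1 z≤b)

-- Null sequences

Eventually : (ℕ → Set) → Set
Eventually P = ∃[ N ] (∀ n → N ℕ.≤ n → P n)

eventually-map : ∀ {P Q : ℕ → Set} → (∀ n → P n → Q n) → Eventually P → Eventually Q
eventually-map f (N , p) = N , λ n N≤n → f n (p n N≤n)

eventually-zip : ∀ {P Q R : ℕ → Set} → (∀ n → P n → Q n → R n) → Eventually P → Eventually Q → Eventually R
eventually-zip f (M , p) (N , q) = M ℕ.⊔ N , λ n n≥ →
  f n (p n (ℕ.m⊔n≤o⇒m≤o M N n≥)) (q n (ℕ.m⊔n≤o⇒n≤o M N n≥))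

eventually-¬⊥ : ¬ Eventually (λ _ → ⊥)
eventually-¬⊥ (N , absurd) = absurd N ℕ.≤-refl

Null : (ℕ → ℚ[i]) → Set
Null s = ∀ β → 0ℚ ℚ.< β → Eventually (λ n → Bound (s n) β)

Bounded : (ℕ → ℚ[i]) → Set
Bounded s = ∃[ b ] Eventually (λ n → Bound (s n) b)

null-cong : ∀ {s t} → (∀ n → s n ≡ t n) → Null s → Null t
null-cong s≡t null β 0<β = eventually-map (λ n → subst (λ z → Bound z β) (s≡t n)) (null β 0<β)

null-⊕ : ∀ {s t} → Null s → Null t → Null (λ n → s n ⊕ t n)
null-⊕ {s} {t} s₀ t₀ β 0<β = eventually-zip
  (λ n s≤ t≤ → subst (Bound (s n ⊕ t n)) (half+half β) (bound-⊕ s≤ t≤))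
  (s₀ _ (0<* 0<½ 0<β)) (t₀ _ (0<* 0<½ 0<β))

null-neg : ∀ {s} → Null s → Null (λ n → ⊖ s n)
null-neg s₀ β 0<β = eventually-map (λ n → bound-neg) (s₀ β 0<β)

null-· : ∀ {s t} → Bounded s → Null t → Null (λ n → s n · t n)
null-· {s} {t} (b , s≤b) t₀ β 0<β =
  -- The bound b may be 0, so β is divided by 1 + b instead.
  let 0<1+b       = ℚ.<-≤-trans (ℚ.positive⁻¹ 1ℚ) (p≤p+q {1ℚ} (Bound.nonNeg (proj₂ s≤b _ ℕ.≤-refl)))
      (γ , 0<γ , eq) = divide 0<1+b 0<β
  in eventually-zip (λ n s≤ t≤ → subst (Bound (s n · t n)) eq
       (bound-· (bound-weaken (subst (b ℚ.≤_) (ℚ.+-comm b 1ℚ) (p≤p+q (ℚ.<⇒≤ (ℚ.positive⁻¹ 1ℚ)))) s≤) t≤))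
     s≤b (t₀ γ 0<γ)

bounded-at : ∀ z → Bounded (at z)
bounded-at z =
  let (a , 0<a , x≤a) = Cauchy-Facts.eventually-bounded (seq (re z)) (cauchy (re z))
      (b , 0<b , y≤b) = Cauchy-Facts.eventually-bounded (seq (im z)) (cauchy (im z))
      abs² : ∀ {p c} → ∣ p ∣ ℚ.≤ c → p ℚ.* p ℚ.≤ c ℚ.* c
      abs² {p} {c} p≤c = subst (ℚ._≤ c ℚ.* c) (∣p∣²≡p² p) (Sqrt-Facts.square-mono (ℚ.0≤∣p∣ p) p≤c)
      0≤ab = 0≤* (ℚ.<⇒≤ 0<a) (ℚ.<⇒≤ 0<b)
  in a ℚ.+ b , eventually-zip (λ n x≤ y≤ → ℚ.+-mono-≤ (ℚ.<⇒≤ 0<a) (ℚ.<⇒≤ 0<b) , (begin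
       norm (at z n)             ≤⟨ ℚ.+-mono-≤ (abs² x≤) (abs² y≤) ⟩
       a ℚ.* a ℚ.+ b ℚ.* b       ≤⟨ p≤p+q (ℚ.+-mono-≤ 0≤ab 0≤ab) ⟩
       a ℚ.* a ℚ.+ b ℚ.* b ℚ.+ (a ℚ.* b ℚ.+ a ℚ.* b)
         ≡⟨ solve 2 (λ a b → a :* a :+ b :* b :+ (a :* b :+ a :* b) := (a :+ b) :* (a :+ b)) refl a b ⟩
       (a ℚ.+ b) ℚ.* (a ℚ.+ b)   ∎)) x≤a y≤b
  where
  open ℚ.≤-Reasoning
  open +-*-Solver using (solve; _:=_; _:+_; _:*_)

root⇒null : ∀ p z → IsRoot p z → Null (λ n → evalAt p (at z n))
root⇒null p z (x₀ , y₀) β 0<β = eventually-zip (λ n x< y< →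
    subst (λ w → Bound w β) (at-eval p z n) (small n x< y<))
  (x₀ e 0<e) (y₀ e 0<e)
  where
  open ℚ.≤-Reasoning
  open +-*-Solver using (solve; _:=_; _:+_; _:*_; _:-_; con)
  e = ℚ.½ ℚ.* β
  0<e = 0<* 0<½ 0<β
  0≤e² = 0≤* (ℚ.<⇒≤ 0<e) (ℚ.<⇒≤ 0<e)
  square< : ∀ p → ∣ p ℚ.- 0ℚ ∣ ℚ.< e → p ℚ.* p ℚ.≤ e ℚ.* e
  square< p p<e = subst (ℚ._≤ e ℚ.* e)
    (trans (∣p∣²≡p² (p ℚ.- 0ℚ)) (solve 1 (λ p → (p :- con 0ℚ) :* (p :- con 0ℚ) := p :* p) refl p))
    (Sqrt-Facts.square-mono (ℚ.0≤∣p∣ (p ℚ.- 0ℚ)) (ℚ.<⇒≤ p<e))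
  small : ∀ n → ∣ seq (re (eval p z)) n ℚ.- 0ℚ ∣ ℚ.< e → ∣ seq (im (eval p z)) n ℚ.- 0ℚ ∣ ℚ.< e →
    Bound (at (eval p z) n) β
  small n x< y< = ℚ.<⇒≤ 0<β , (begin
    norm (at (eval p z) n)                    ≤⟨ ℚ.+-mono-≤ (square< (seq (re (eval p z)) n) x<) (square< (seq (im (eval p z)) n) y<) ⟩
    e ℚ.* e ℚ.+ e ℚ.* e                       ≤⟨ p≤p+q (ℚ.+-mono-≤ 0≤e² 0≤e²) ⟩
    e ℚ.* e ℚ.+ e ℚ.* e ℚ.+ (e ℚ.* e ℚ.+ e ℚ.* e)
      ≡⟨ solve 1 (λ e → e :* e :+ e :* e :+ (e :* e :+ e :* e) := (e :+ e) :* (e :+ e)) refl e ⟩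
    (e ℚ.+ e) ℚ.* (e ℚ.+ e)                   ≡⟨ cong₂ ℚ._*_ (half+half β) (half+half β) ⟩
    β ℚ.* β                                   ∎)

-- Certificates for the absence of small roots

absEval : ℤ[x] → ℚ → ℚ
absEval []      t = 0ℚ
absEval (c ∷ p) t = ∣ c / 1 ∣ ℚ.+ t ℚ.* absEval p t

bound-eval : ∀ p {z t} → Bound z t → Bound (⟦ p ⟧ z) (absEval p t)
bound-eval []      z≤t = bound-real 0ℚ
bound-eval (c ∷ p) z≤t = bound-⊕ (bound-real (c / 1)) (bound-· z≤t (bound-eval p z≤t))

-- If p has constant term c = ±1, this is the power series of c/p up to degree n.

reciprocal : ℕ → ℤ[x] → ℤ[x]
reciprocal zero    p       = const (+ 1)
reciprocal (suc n) []      = []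
reciprocal (suc n) (c ∷ p) = take (suc (suc n)) (const (+ 1) +ₚ (const (+ 1) -ₚ const c *ₚ (c ∷ p)) *ₚ reciprocal n (c ∷ p))

-- Slightly larger than (√5 - 1)/2 = 0.6180…

ρ : ℚ
ρ = + 13 / 21

combine : (p p₁ p₂ p₃ : ℤ[x]) (z w v : ℚ[i]) → ℚ[i]
combine p p₁ p₂ p₃ z w v = ⟦ p ⟧ z ⊕ w · ⟦ p₁ ⟧ z ⊕ v · (⟦ p₂ ⟧ z ⊕ w · ⟦ p₃ ⟧ z)

-- The factors 1 bound w and v; they are kept so that the expression is literally the one that
-- `bound-⊕` and `bound-·` produce.
remainder : (q q₁ q₂ q₃ : ℤ[x]) → ℚ
remainder q q₁ q₂ q₃ = ρ ℚ.* absEval q ρ ℚ.+ 1ℚ ℚ.* absEval q₁ ρ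
  ℚ.+ 1ℚ ℚ.* (absEval q₂ ρ ℚ.+ 1ℚ ℚ.* absEval q₃ ρ)

-- On concrete polynomials the decision evaluates and the type becomes the unit type, so that
-- certificates can be given as `_`.
Dominant : (q q₁ q₂ q₃ : ℤ[x]) → Set
Dominant []      q₁ q₂ q₃ = ⊥
Dominant (c ∷ q) q₁ q₂ q₃ = True (remainder q q₁ q₂ q₃ ℚ.<? ∣ c / 1 ∣)

-- If ∣z∣ ≤ ρ, ∣w∣ ≤ 1 and ∣v∣ ≤ 1, then the constant term of u (p + w p₁ + v (p₂ + w p₃)) outweighs
-- all other terms.  The degree 8 of u is enough for all polynomials considered below.

Certified : (p p₁ p₂ p₃ : ℤ[x]) → Set
Certified p p₁ p₂ p₃ = Dominant (u *ₚ p) (u *ₚ p₁) (u *ₚ p₂) (u *ₚ p₃)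
  where u = reciprocal 8 p

-- The constant c equals u times the combination, minus all other terms. The triangle inequality
-- then bounds it.
dominant-lower-bound : ∀ u p p₁ p₂ p₃ {c q} → u *ₚ p ≡ c ∷ q →
  ∀ {z w v β} → Bound z ρ → Bound w 1ℚ → Bound v 1ℚ → Bound (combine p p₁ p₂ p₃ z w v) β →
  ∣ c / 1 ∣ ℚ.≤ absEval u ρ ℚ.* β ℚ.+ remainder q (u *ₚ p₁) (u *ₚ p₂) (u *ₚ p₃)
dominant-lower-bound u p p₁ p₂ p₃ {c} {q} up≡ {z} {w} {v} {β} z≤ w≤ v≤ s≤ = bound-real⁻¹
  (subst (λ x → Bound x (absEval u ρ ℚ.* β ℚ.+ remainder q (u *ₚ p₁) (u *ₚ p₂) (u *ₚ p₃))) eq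
    (bound-⊕ (bound-· (bound-eval u z≤) s≤) (bound-neg rest≤)))
  where
  open Solver using (solve; _:=_; _:+_; _:*_; _:-_)
  rest = z · ⟦ q ⟧ z ⊕ w · ⟦ u *ₚ p₁ ⟧ z ⊕ v · (⟦ u *ₚ p₂ ⟧ z ⊕ w · ⟦ u *ₚ p₃ ⟧ z)
  rest≤ : Bound rest (remainder q (u *ₚ p₁) (u *ₚ p₂) (u *ₚ p₃))
  rest≤ = bound-⊕ (bound-⊕ (bound-· z≤ (bound-eval q z≤)) (bound-· w≤ (bound-eval (u *ₚ p₁) z≤)))
    (bound-· v≤ (bound-⊕ (bound-eval (u *ₚ p₂) z≤) (bound-· w≤ (bound-eval (u *ₚ p₃) z≤))))
  eq : ⟦ u ⟧ z · combine p p₁ p₂ p₃ z w v ⊕ ⊖ rest ≡ ι c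
  eq = begin
    U · combine p p₁ p₂ p₃ z w v ⊕ ⊖ rest
      ≡⟨ cong (λ r → U · combine p p₁ p₂ p₃ z w v ⊕ ⊖ r) (cong₂ (λ a b → z · ⟦ q ⟧ z ⊕ w · a ⊕ b) (eval-* u p₁ z)
           (cong₂ (λ a b → v · (a ⊕ w · b)) (eval-* u p₂ z) (eval-* u p₃ z))) ⟩
    U · combine p p₁ p₂ p₃ z w v ⊕ ⊖ (z · ⟦ q ⟧ z ⊕ w · (U · ⟦ p₁ ⟧ z) ⊕ v · (U · ⟦ p₂ ⟧ z ⊕ w · (U · ⟦ p₃ ⟧ z)))
      ≡⟨ solve 8 (λ u p p₁ p₂ p₃ zq w v → u :* (p :+ w :* p₁ :+ v :* (p₂ :+ w :* p₃))
           :- (zq :+ w :* (u :* p₁) :+ v :* (u :* p₂ :+ w :* (u :* p₃))) := u :* p :- zq) refl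
           U (⟦ p ⟧ z) (⟦ p₁ ⟧ z) (⟦ p₂ ⟧ z) (⟦ p₃ ⟧ z) (z · ⟦ q ⟧ z) w v ⟩
    U · ⟦ p ⟧ z ⊕ ⊖ (z · ⟦ q ⟧ z)
      ≡⟨ cong (λ x → x ⊕ ⊖ (z · ⟦ q ⟧ z)) (trans (sym (eval-* u p z)) (cong (λ r → ⟦ r ⟧ z) up≡)) ⟩
    ι c ⊕ z · ⟦ q ⟧ z ⊕ ⊖ (z · ⟦ q ⟧ z)
      ≡⟨ solve 2 (λ c x → c :+ x :- x := c) refl (ι c) (z · ⟦ q ⟧ z) ⟩
    ι c ∎
    where
    open ≡-Reasoning
    U = ⟦ u ⟧ z

certified⇒¬null : ∀ p p₁ p₂ p₃ → Certified p p₁ p₂ p₃ →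
  ∀ {s w v : ℕ → ℚ[i]} → Eventually (λ n → Bound (s n) ρ) →
  (∀ n → Bound (s n) ρ → Bound (w n) 1ℚ) → (∀ n → Bound (s n) ρ → Bound (v n) 1ℚ) →
  ¬ Null (λ n → combine p p₁ p₂ p₃ (s n) (w n) (v n))
certified⇒¬null p p₁ p₂ p₃ cert {s} {w} {v} s≤ρ w≤1 v≤1 s₀ = main (u *ₚ p) refl cert
  where
  open ℚ.≤-Reasoning
  u = reciprocal 8 p
  -- The product is generalised to a list r, on whose head, the constant term, `Dominant` can be
  -- split.
  main : ∀ r → u *ₚ p ≡ r → Dominant r (u *ₚ p₁) (u *ₚ p₂) (u *ₚ p₃) → ⊥
  main (c ∷ q) up≡ dom = eventually-¬⊥ (eventually-zip absurd s≤ρ (s₀ β (proj₁ (proj₂ β-choice))))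
    where
    R = remainder q (u *ₚ p₁) (u *ₚ p₂) (u *ₚ p₃)
    A = absEval u ρ
    R<c : R ℚ.< ∣ c / 1 ∣
    R<c = toWitness dom
    0≤A : 0ℚ ℚ.≤ A
    0≤A = Bound.nonNeg (bound-eval u (proj₂ s≤ρ _ ℕ.≤-refl))
    gap = ∣ c / 1 ∣ ℚ.- R
    0<gap : 0ℚ ℚ.< gap
    0<gap = subst (ℚ._< gap) (ℚ.+-inverseʳ R) (ℚ.+-monoˡ-< (ℚ.- R) R<c)
    -- Using 1 + A instead of A makes the divisor positive and the final estimate strict.
    β-choice = divide (ℚ.<-≤-trans (ℚ.positive⁻¹ 1ℚ) (p≤p+q {1ℚ} 0≤A)) 0<gap
    β = proj₁ β-choice
    absurd : ∀ n → Bound (s n) ρ → Bound (combine p p₁ p₂ p₃ (s n) (w n) (v n)) β → ⊥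
    absurd n z≤ c≤ = ℚ.<-irrefl refl (begin-strict
      ∣ c / 1 ∣               ≤⟨ dominant-lower-bound u p p₁ p₂ p₃ up≡ z≤ (w≤1 n z≤) (v≤1 n z≤) c≤ ⟩
      A ℚ.* β ℚ.+ R           <⟨ ℚ.+-monoˡ-< R (ℚ.*-monoˡ-<-pos β {{ℚ.positive (proj₁ (proj₂ β-choice))}} A<1+A) ⟩
      (1ℚ ℚ.+ A) ℚ.* β ℚ.+ R  ≡⟨ cong (ℚ._+ R) (proj₂ (proj₂ β-choice)) ⟩
      gap ℚ.+ R               ≡⟨ +-*-Solver.solve 2 (λ c r → c :- r :+ r := c) refl ∣ c / 1 ∣ R ⟩
      ∣ c / 1 ∣               ∎)
      where
      open +-*-Solver using (_:=_; _:+_; _:-_)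
      A<1+A : A ℚ.< 1ℚ ℚ.+ A
      A<1+A = subst (ℚ._< 1ℚ ℚ.+ A) (ℚ.+-identityˡ A) (ℚ.+-monoˡ-< A (ℚ.positive⁻¹ 1ℚ))

-- Roots of a rational polynomial are inherited by Galois conjugates

length-∷ʳ : ∀ {A : Set} (as : List A) a → length (as ∷ʳ a) ≡ suc (length as)
length-∷ʳ as a = trans (length-++ as) (ℕ.+-comm (length as) 1)

module _ where
  open Solver using (solve; _:=_; _:+_; _:*_; _:-_; :-_; con)

  -- f + a x^k g

  addScaled : ℚ[x] → ℚ → ℕ → ℚ[x] → ℚ[x]
  addScaled f       a k       []      = f
  addScaled []      a zero    (d ∷ g) = a ℚ.* d ∷ addScaled [] a zero g
  addScaled (c ∷ f) a zero    (d ∷ g) = c ℚ.+ a ℚ.* d ∷ addScaled f a zero g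
  addScaled []      a (suc k) g@(_ ∷ _) = 0ℚ ∷ addScaled [] a k g
  addScaled (c ∷ f) a (suc k) g@(_ ∷ _) = c ∷ addScaled f a k g

  length-addScaled : ∀ f a k g → length (addScaled f a k g) ≤ length f ℕ.⊔ (k ℕ.+ length g)
  length-addScaled f       a k       []      = ℕ.m≤m⊔n (length f) _
  length-addScaled []      a zero    (d ∷ g) = s≤s (length-addScaled [] a zero g)
  length-addScaled (c ∷ f) a zero    (d ∷ g) = s≤s (length-addScaled f a zero g)
  length-addScaled []      a (suc k) g@(_ ∷ _) = s≤s (length-addScaled [] a k g)
  length-addScaled (c ∷ f) a (suc k) g@(_ ∷ _) = s≤s (length-addScaled f a k g)

  evalAt-addScaled : ∀ f a k g z → evalAt (addScaled f a k g) z ≡ evalAt f z ⊕ real a · (power z k · evalAt g z)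
  evalAt-addScaled f a k [] z = solve 3 (λ f a w → f := f :+ a :* (w :* con (+ 0))) refl (evalAt f z) (real a) (power z k)
  evalAt-addScaled [] a zero (d ∷ g) z = trans
    (cong₂ (λ u v → u ⊕ z · v) (real-· a d) (evalAt-addScaled [] a zero g z))
    (solve 4 (λ a d z g → a :* d :+ z :* (con (+ 0) :+ a :* (con (+ 1) :* g)) := con (+ 0) :+ a :* (con (+ 1) :* (d :+ z :* g)))
      refl (real a) (real d) z (evalAt g z))
  evalAt-addScaled (c ∷ f) a zero (d ∷ g) z = trans
    (cong₂ (λ u v → real c ⊕ u ⊕ z · v) (real-· a d) (evalAt-addScaled f a zero g z))
    (solve 6 (λ a d z g c f → c :+ a :* d :+ z :* (f :+ a :* (con (+ 1) :* g)) := c :+ z :* f :+ a :* (con (+ 1) :* (d :+ z :* g)))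
      refl (real a) (real d) z (evalAt g z) (real c) (evalAt f z))
  evalAt-addScaled [] a (suc k) g@(_ ∷ _) z = trans
    (cong (λ v → real 0ℚ ⊕ z · v) (evalAt-addScaled [] a k g z))
    (solve 4 (λ a z w g → con (+ 0) :+ z :* (con (+ 0) :+ a :* (w :* g)) := con (+ 0) :+ a :* (z :* w :* g))
      refl (real a) z (power z k) (evalAt g z))
  evalAt-addScaled (c ∷ f) a (suc k) g@(_ ∷ _) z = trans
    (cong (λ v → real c ⊕ z · v) (evalAt-addScaled f a k g z))
    (solve 6 (λ a z w g c f → c :+ z :* (f :+ a :* (w :* g)) := c :+ z :* f :+ a :* (z :* w :* g))
      refl (real a) z (power z k) (evalAt g z) (real c) (evalAt f z))

  evalAt-∷ʳ : ∀ f a z → evalAt (f ∷ʳ a) z ≡ evalAt f z ⊕ real a · power z (length f)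
  evalAt-∷ʳ []      a z = solve 2 (λ a z → a :+ z :* con (+ 0) := con (+ 0) :+ a :* con (+ 1)) refl (real a) z
  evalAt-∷ʳ (c ∷ f) a z = trans (cong (λ v → real c ⊕ z · v) (evalAt-∷ʳ f a z))
    (solve 5 (λ c z f a w → c :+ z :* (f :+ a :* w) := c :+ z :* f :+ a :* (z :* w)) refl
      (real c) z (evalAt f z) (real a) (power z (length f)))

  evalAt-scale : ∀ a f z → evalAt (map (a ℚ.*_) f) z ≡ real a · evalAt f z
  evalAt-scale a []      z = solve 1 (λ a → con (+ 0) := a :* con (+ 0)) refl (real a)
  evalAt-scale a (c ∷ f) z = trans (cong₂ (λ u v → u ⊕ z · v) (real-· a c) (evalAt-scale a f z))
    (solve 4 (λ a c z f → a :* c :+ z :* (a :* f) := a :* (c :+ z :* f)) refl (real a) (real c) z (evalAt f z))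

  evalAt-normalise : ∀ b a f → b ℚ.* a ≡ 1ℚ → ∀ z →
    evalAt (map (b ℚ.*_) f ∷ʳ 1ℚ) z ≡ real b · evalAt (f ∷ʳ a) z
  evalAt-normalise b a f ba≡1 z = begin
    evalAt (map (b ℚ.*_) f ∷ʳ 1ℚ) z
      ≡⟨ evalAt-∷ʳ (map (b ℚ.*_) f) 1ℚ z ⟩
    evalAt (map (b ℚ.*_) f) z ⊕ real 1ℚ · power z (length (map (b ℚ.*_) f))
      ≡⟨ cong₂ (λ u l → u ⊕ real 1ℚ · power z l) (evalAt-scale b f z) (length-map (b ℚ.*_) f) ⟩
    real b · evalAt f z ⊕ real 1ℚ · power z (length f)
      ≡⟨ cong (λ u → real b · evalAt f z ⊕ u · power z (length f)) (trans (cong real (sym ba≡1)) (real-· b a)) ⟩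
    real b · evalAt f z ⊕ real b · real a · power z (length f)
      ≡⟨ solve 4 (λ b f a w → b :* f :+ b :* a :* w := b :* (f :+ a :* w)) refl (real b) (evalAt f z) (real a) (power z (length f)) ⟩
    real b · (evalAt f z ⊕ real a · power z (length f))
      ≡⟨ cong (real b ·_) (sym (evalAt-∷ʳ f a z)) ⟩
    real b · evalAt (f ∷ʳ a) z ∎
    where open ≡-Reasoning

  NullOn : ℚ[x] → (ℕ → ℚ[i]) → Set
  NullOn p s = Null (λ n → evalAt p (s n))

  module _ (x y : ℕ → ℚ[i]) (x-bounded : Bounded x) (y-bounded : Bounded y)
    (cs : ℚ[x]) (px₀ : NullOn (cs ∷ʳ 1ℚ) x) (py₀ : NullOn (cs ∷ʳ 1ℚ) y)
    (minimal : ∀ f → NullOn (f ∷ʳ 1ℚ) x → length cs ≤ length f)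
    where

    -- Division by the minimal polynomial, one leading term at a time: a zero coefficient is
    -- dropped, any other is removed by subtracting a multiple of the minimal polynomial, which is
    -- null along both x and y. The bound n on the length drives the recursion.
    null-transfer : ∀ n f → length f ≤ n → NullOn f x → NullOn f y
    null-transfer n f len fx₀ with initLast f
    null-transfer n       .[] len fx₀ | [] = λ β 0<β → 0 , λ _ _ → bound-weaken (ℚ.<⇒≤ 0<β) (bound-real 0ℚ)
    null-transfer zero    .(f ∷ʳ a) len fx₀ | f ∷ʳ′ a = ⊥-elim (ℕ.n≮0 (subst (_≤ 0) (length-∷ʳ f a) len))
    null-transfer (suc n) .(f ∷ʳ a) len fx₀ | f ∷ʳ′ a with a ℚ.≟ 0ℚ
    ... | yes refl = null-cong (λ m → sym (drop0 (y m)))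
      (null-transfer n f len′ (null-cong (λ m → drop0 (x m)) fx₀))
      where
      len′ : length f ≤ n
      len′ = ℕ.≤-pred (subst (_≤ suc n) (length-∷ʳ f 0ℚ) len)
      drop0 : ∀ z → evalAt (f ∷ʳ 0ℚ) z ≡ evalAt f z
      drop0 z = trans (evalAt-∷ʳ f 0ℚ z) (solve 2 (λ f w → f :+ con (+ 0) :* w := f) refl (evalAt f z) (power z (length f)))
    ... | no a≢0 = null-cong (λ m → sym (expand (y m)))
        (null-⊕ (null-transfer n g g≤n gx₀) (shifted y y-bounded py₀))
      where
      instance _ = ℚ.≢-nonZero a≢0
      len′ : length f ≤ n
      len′ = ℕ.≤-pred (subst (_≤ suc n) (length-∷ʳ f a) len)
      -- Division by a yields a monic polynomial that is null along x, to which minimality applies.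
      cs≤f : length cs ≤ length f
      cs≤f = subst (length cs ≤_) (length-map (ℚ.1/ a ℚ.*_) f) (minimal (map (ℚ.1/ a ℚ.*_) f)
        (null-cong (λ m → sym (evalAt-normalise (ℚ.1/ a) a f (ℚ.*-inverseˡ a) (x m))) (null-· (∣ ℚ.1/ a ∣ , 0 , λ _ _ → bound-real (ℚ.1/ a)) fx₀)))
      k = length f ℕ.∸ length cs
      k+cs≡f : k ℕ.+ length cs ≡ length f
      k+cs≡f = ℕ.m∸n+n≡m cs≤f
      -- The top terms of `f ∷ʳ a` and of the subtracted multiple cancel; they never enter g, so its
      -- length drops without any arithmetic on coefficients.
      g = addScaled f (ℚ.- a) k cs
      g≤n : length g ≤ n
      g≤n = ℕ.≤-trans (length-addScaled f (ℚ.- a) k cs)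
        (ℕ.⊔-lub len′ (subst (_≤ n) (sym k+cs≡f) len′))
      expand : ∀ z → evalAt (f ∷ʳ a) z ≡ evalAt g z ⊕ real a · (power z k · evalAt (cs ∷ʳ 1ℚ) z)
      expand z = sym (begin
        evalAt g z ⊕ real a · (power z k · evalAt (cs ∷ʳ 1ℚ) z)
          ≡⟨ cong₂ (λ u v → u ⊕ real a · (power z k · v)) (evalAt-addScaled f (ℚ.- a) k cs z) (evalAt-∷ʳ cs 1ℚ z) ⟩
        evalAt f z ⊕ ⊖ real a · (power z k · evalAt cs z) ⊕ real a · (power z k · (evalAt cs z ⊕ real 1ℚ · power z (length cs)))
          ≡⟨ solve 5 (λ f a w c v → f :+ :- a :* (w :* c) :+ a :* (w :* (c :+ con (+ 1) :* v)) := f :+ a :* (w :* v)) refl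
               (evalAt f z) (real a) (power z k) (evalAt cs z) (power z (length cs)) ⟩
        evalAt f z ⊕ real a · (power z k · power z (length cs))
          ≡⟨ cong (λ w → evalAt f z ⊕ real a · w) (trans (sym (power-+ z k (length cs))) (cong (power z) k+cs≡f)) ⟩
        evalAt f z ⊕ real a · power z (length f)
          ≡⟨ evalAt-∷ʳ f a z ⟨
        evalAt (f ∷ʳ a) z ∎)
        where open ≡-Reasoning
      bounded-power : ∀ s → Bounded s → ∀ j → Bounded (λ m → power (s m) j)
      bounded-power s s≤ zero    = ∣ 1ℚ ∣ , 0 , λ _ _ → bound-real 1ℚ
      bounded-power s s≤@(b , s≤b) (suc j) = let (c , w≤c) = bounded-power s s≤ j in
        b ℚ.* c , eventually-zip (λ m → bound-·) s≤b w≤c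
      shifted : ∀ s → Bounded s → NullOn (cs ∷ʳ 1ℚ) s → Null (λ m → real a · (power (s m) k · evalAt (cs ∷ʳ 1ℚ) (s m)))
      shifted s s≤ p₀ = null-· (∣ a ∣ , 0 , λ _ _ → bound-real a) (null-· (bounded-power s s≤ k) p₀)
      gx₀ : NullOn g x
      gx₀ = null-cong (λ m → trans (cong (λ u → u ⊕ ⊖ (real a · (power (x m) k · evalAt (cs ∷ʳ 1ℚ) (x m)))) (expand (x m)))
          (solve 2 (λ g p → g :+ p :- p := g) refl (evalAt g (x m)) _))
        (null-⊕ fx₀ (null-neg (shifted x x-bounded px₀)))

-- Polynomials without small roots

NullAt : ℤ[x] → (ℕ → ℚ[i]) → Set
NullAt p s = Null (λ n → ⟦ p ⟧ (s n))

-- The positive root of T² + T = 1 is (√5 - 1)/2.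

Small : (ℕ → ℚ[i]) → Set
Small s = ∃[ T ] T ℚ.* T ℚ.+ T ℚ.< 1ℚ × Eventually (λ n → Bound (s n) T)

-- A wrapper from which unification recovers x, unlike from P x itself.

record Holds {A : Set} (P : A → Set) (x : A) : Set where
  constructor holds
  field
    proof : P x

open Holds

NoSmallRoot : ℤ[x] → Set
NoSmallRoot p = ∀ s → Small s → ¬ NullAt p s

Avoids : ℤ[x] → Set
Avoids = Holds NoSmallRoot

-- Since ρ² + ρ = 442/441, a T above ρ would contradict T² + T < 1.
small⇒ρ : ∀ {s} → Small s → Eventually (λ n → Bound (s n) ρ)
small⇒ρ {s} (T , T²+T<1 , s≤T) = eventually-map (λ n s≤ → bound-weaken (T≤ρ s≤) s≤) s≤T
  where
  T≤ρ : ∀ {z} → Bound z T → T ℚ.≤ ρ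
  T≤ρ (0≤T , _) = ℚ.≮⇒≥ λ ρ<T → ℚ.<-irrefl refl (ℚ.≤-<-trans
    (ℚ.≤-trans (toWitness {a? = 1ℚ ℚ.≤? ρ ℚ.* ρ ℚ.+ ρ} _)
      (ℚ.+-mono-≤ (*-mono-≤ 0≤T (toWitness {a? = 0ℚ ℚ.≤? ρ} _) (ℚ.<⇒≤ ρ<T) (ℚ.<⇒≤ ρ<T)) (ℚ.<⇒≤ ρ<T)))
    T²+T<1)

ρ≤1 : ρ ℚ.≤ 1ℚ
ρ≤1 = toWitness {a? = ρ ℚ.≤? 1ℚ} _

small⇒bounded : ∀ {s} → Small s → Bounded s
small⇒bounded (T , _ , s≤T) = T , s≤T

null-multiple : ∀ m p {s} → Bounded s → NullAt p s → Null (λ n → ⟦ m ⟧ (s n) · ⟦ p ⟧ (s n))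
null-multiple m p (b , s≤b) = null-· (absEval m b , eventually-map (λ n → bound-eval m) s≤b)

null-signed : ∀ s {t} → Null t → Null (λ n → signed s (t n))
null-signed Sign.+ = λ t₀ → t₀
null-signed Sign.- = null-neg

bound-signed : ∀ s {z b} → Bound z b → Bound (signed s z) b
bound-signed Sign.+ = λ z≤b → z≤b
bound-signed Sign.- = bound-neg

-- The certificate is applied to m p, which is null wherever p is, with v = 1 and p₂ = p₃ = 0.
avoids-split : ∀ {m i p p₀ p₁} → Split m i p p₀ p₁ → Certified p₀ p₁ [] [] → Avoids p
avoids-split {m} {i} {p} {p₀} {p₁} p-split cert = holds λ t t-small t₀ → certified⇒¬null p₀ p₁ [] [] cert
  {w = λ k → power (t k) i} {v = λ _ → real 1ℚ} (small⇒ρ t-small) (λ k → bound-power i ρ≤1) (λ k _ → bound-real 1ℚ)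
  (null-cong (λ k → trans (identity p-split (t k))
      (solve 3 (λ a w b → a :+ w :* b := a :+ w :* b :+ con (+ 1) :* (con (+ 0) :+ w :* con (+ 0))) refl
        (⟦ p₀ ⟧ (t k)) (power (t k) i) (⟦ p₁ ⟧ (t k))))
    (null-multiple m p (small⇒bounded t-small) t₀))
  where open Solver using (solve; _:=_; _:+_; _:*_; con)

avoids-fixed : ∀ {m i f f₀ f₁ g g₀ g₁} → Split m i f f₀ f₁ → Split m i g g₀ g₁ → ∀ n s →
  Certified (f₀ *ₚ x^ n ±[ s ] g₀) (f₁ *ₚ x^ n ±[ s ] g₁) [] [] → Avoids (f *ₚ x^ n ±[ s ] g)
avoids-fixed f-split g-split n s = avoids-split (split-± f-split g-split n s)

-- All n ≥ N are treated at once: the correction g supplies p₀, while f xⁿ, small on the disc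
-- because of its high power of x, goes with v = ± xʲ.
avoids-beyond : ∀ {m i f f₀ f₁ g g₀ g₁} → Split m i f f₀ f₁ → Split m i g g₀ g₁ → ∀ N j s →
  Certified g₀ g₁ (f₀ *ₚ x^ N) (f₁ *ₚ x^ N) → Avoids (f *ₚ x^ (N ℕ.+ j) ±[ s ] g)
avoids-beyond {m} {i} {f} {f₀} {f₁} {g} {g₀} {g₁} f-split g-split N j s cert = holds λ t t-small t₀ →
  certified⇒¬null g₀ g₁ (f₀ *ₚ x^ N) (f₁ *ₚ x^ N) cert
    {w = λ k → power (t k) i} {v = λ k → signed s (power (t k) j)} (small⇒ρ t-small)
    (λ k → bound-power i ρ≤1) (λ k t≤ → bound-signed s (bound-power j ρ≤1 t≤))
    (null-cong (λ k → signed-expand-± f-split g-split N j s (t k))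
      (null-signed s (null-multiple m (f *ₚ x^ (N ℕ.+ j) ±[ s ] g) (small⇒bounded t-small) t₀)))

-- The polynomial x² - x - 1 and its multiples

module _ where
  open Solver using (solve; _:=_; _:+_; _:*_; _:-_; :-_; con)

  -- From 1 = z² - z - (z² - z - 1). Here the exact radius counts, and T cannot be replaced by ρ.
  golden-lower-bound : ∀ {z T β} → Bound z T → Bound (⟦ Φ 1 ⟧ z) β → 1ℚ ℚ.≤ T ℚ.* T ℚ.+ T ℚ.+ β
  golden-lower-bound {z} {T} {β} z≤T g≤β = bound-real⁻¹ (subst (λ v → Bound v (T ℚ.* T ℚ.+ T ℚ.+ β)) eq
    (bound-⊕ (bound-⊕ (bound-· z≤T z≤T) (bound-neg z≤T)) (bound-neg g≤β)))
    where
    eq : z · z ⊕ ⊖ z ⊕ ⊖ ⟦ Φ 1 ⟧ z ≡ real 1ℚ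
    eq = solve 1 (λ z → z :* z :- z :- (con (ℤ.- (+ 1)) :+ z :* (con (ℤ.- (+ 1)) :+ z :* (con (+ 1) :+ z :* con (+ 0)))) := con (+ 1)) refl z

half<1 : ∀ {δ} → 0ℚ ℚ.< δ → ½ ℚ.* δ ℚ.< δ
half<1 {δ} 0<δ = subst (½ ℚ.* δ ℚ.<_) (half+half δ)
  (subst (ℚ._< ½ ℚ.* δ ℚ.+ ½ ℚ.* δ) (ℚ.+-identityʳ (½ ℚ.* δ)) (ℚ.+-monoʳ-< (½ ℚ.* δ) (0<* 0<½ 0<δ)))

module GoldenGap {T} (T²+T<1 : T ℚ.* T ℚ.+ T ℚ.< 1ℚ) where
  gap δ : ℚ
  gap = 1ℚ ℚ.- (T ℚ.* T ℚ.+ T)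
  δ = ½ ℚ.* gap

  0<gap : 0ℚ ℚ.< gap
  0<gap = subst (ℚ._< gap) (ℚ.+-inverseʳ (T ℚ.* T ℚ.+ T)) (ℚ.+-monoˡ-< (ℚ.- (T ℚ.* T ℚ.+ T)) T²+T<1)

  0<δ : 0ℚ ℚ.< δ
  0<δ = 0<* 0<½ 0<gap

  golden≰δ : ∀ {z} → Bound z T → ¬ Bound (⟦ Φ 1 ⟧ z) δ
  golden≰δ {z} z≤T g≤δ = ℚ.<-irrefl refl (begin-strict
    1ℚ                         ≤⟨ golden-lower-bound z≤T g≤δ ⟩
    T ℚ.* T ℚ.+ T ℚ.+ δ        <⟨ ℚ.+-monoʳ-< (T ℚ.* T ℚ.+ T) (half<1 0<gap) ⟩
    T ℚ.* T ℚ.+ T ℚ.+ gap      ≡⟨ solve 1 (λ t → t :+ (con 1ℚ :- t) := con 1ℚ) refl (T ℚ.* T ℚ.+ T) ⟩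
    1ℚ                         ∎)
    where
    open ℚ.≤-Reasoning
    open +-*-Solver using (solve; _:=_; _:+_; _:-_; con)

-- The conjugate (1 - √5)/2 of the golden ratio lies on the bounding circle itself: the bound of the
-- theorem is attained.
golden-avoids : Avoids (Φ 1)
golden-avoids = holds λ s (T , T²+T<1 , s≤T) s₀ → let open GoldenGap {T} T²+T<1 in
  eventually-¬⊥ (eventually-zip (λ n → golden≰δ) s≤T (s₀ δ 0<δ))

-- On the disc x² - x - 1 stays away from 0 by δ, so it can be divided out of a null sequence.
golden-cancel : ∀ {s t} → Small s → Null (λ n → ⟦ Φ 1 ⟧ (s n) · t n) → Null t
golden-cancel {s} {t} (T , T²+T<1 , s≤T) st₀ β 0<β = eventually-zip cancel s≤T (st₀ (δ ℚ.* β) (0<* 0<δ 0<β))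
  where
  open GoldenGap {T} T²+T<1
  open ℚ.≤-Reasoning
  open +-*-Solver using (solve; _:=_; _:*_)
  0<δ² = 0<* 0<δ 0<δ
  instance _ = ℚ.positive 0<δ²
  cancel : ∀ n → Bound (s n) T → Bound (⟦ Φ 1 ⟧ (s n) · t n) (δ ℚ.* β) → Bound (t n) β
  cancel n z≤T (_ , gt≤) = ℚ.<⇒≤ 0<β , ℚ.*-cancelˡ-≤-pos (δ ℚ.* δ) (begin
    δ ℚ.* δ ℚ.* norm (t n)                   ≤⟨ *-mono-≤ (0≤norm g) (0≤norm (t n)) δ²≤g ℚ.≤-refl ⟩
    norm g ℚ.* norm (t n)                    ≡⟨ norm-· g (t n) ⟨
    norm (g · t n)                           ≤⟨ gt≤ ⟩
    δ ℚ.* β ℚ.* (δ ℚ.* β)                    ≡⟨ solve 2 (λ d b → d :* b :* (d :* b) := d :* d :* (b :* b)) refl δ β ⟩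
    δ ℚ.* δ ℚ.* (β ℚ.* β)                    ∎)
    where
    g = ⟦ Φ 1 ⟧ (s n)
    δ²≤g : δ ℚ.* δ ℚ.≤ norm g
    δ²≤g = ℚ.≮⇒≥ λ g<δ² → golden≰δ z≤T (ℚ.<⇒≤ 0<δ , ℚ.<⇒≤ g<δ²)

-- For multiples of Φ 1 = x² - x - 1 no certificate exists: its root (1 - √5)/2 has absolute value below ρ.

avoids-golden-* : ∀ p → Avoids p → Avoids (Φ 1 *ₚ p)
avoids-golden-* p p-avoids = holds λ s s-small s₀ → proof p-avoids s s-small
  (golden-cancel s-small (null-cong (λ n → eval-* (Φ 1) p (s n)) s₀))

-- Real roots in (1,2)

record InsideWith (ε a : ℚ) : Set where
  constructor _,_
  field
    above : 1ℚ ℚ.+ ε ℚ.≤ a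
    below : a ℚ.+ ε ℚ.≤ + 2 / 1

Inside : (ℕ → ℚ) → Set
Inside q = ∃[ ε ] 0ℚ ℚ.< ε × Eventually (λ n → InsideWith ε (q n))

record AtLeast (z : ℚ[i]) (b : ℚ) : Set where
  constructor atLeast
  field
    {part} : ℚ
    isReal : z ≡ real part
    lower  : b ℚ.≤ part

atLeast-⊕ : ∀ {z w b c} → AtLeast z b → AtLeast w c → AtLeast (z ⊕ w) (b ℚ.+ c)
atLeast-⊕ (atLeast refl b≤) (atLeast refl c≤) = atLeast refl (ℚ.+-mono-≤ b≤ c≤)

atLeast-· : ∀ {z w b c} → 0ℚ ℚ.≤ b → 0ℚ ℚ.≤ c → AtLeast z b → AtLeast w c → AtLeast (z · w) (b ℚ.* c)
atLeast-· 0≤b 0≤c (atLeast {a} refl b≤) (atLeast {d} refl c≤) =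
  atLeast (sym (real-· a d)) (*-mono-≤ (ℚ.≤-trans 0≤b b≤) 0≤c b≤ c≤)

atLeast-weaken : ∀ {z b c} → c ℚ.≤ b → AtLeast z b → AtLeast z c
atLeast-weaken c≤b (atLeast z≡ b≤) = atLeast z≡ (ℚ.≤-trans c≤b b≤)

_^ₚ_ : ℤ[x] → ℕ → ℤ[x]
p ^ₚ zero  = one
p ^ₚ suc k = p *ₚ (p ^ₚ k)

2-x : ℤ[x]
2-x = const (+ 2) -ₚ x^ 1

-- c₀ (2-x)^d + c₁ (2-x)^(d-1) (x-1) + ⋯ + c_d (x-1)^d

bernstein : List ℕ → ℤ[x]
bernstein []       = []
bernstein (c ∷ cs) = const (+ c) *ₚ (2-x ^ₚ length cs) +ₚ x-1 *ₚ bernstein cs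

powℚ : ℚ → ℕ → ℚ
powℚ ε zero    = 1ℚ
powℚ ε (suc k) = ε ℚ.* powℚ ε k

Positive : List ℕ → Set
Positive []           = ⊥
Positive (zero ∷ cs)  = Positive cs
Positive (suc _ ∷ cs) = ⊤

-- This bounds the first term with nonzero coefficient alone, the others being nonnegative: that
-- coefficient is at least 1, and x - 1 and 2 - x are at least ε. The empty list gets a positive
-- default.
minorant : ℚ → List ℕ → ℚ
minorant ε []           = 1ℚ
minorant ε (zero ∷ cs)  = ε ℚ.* minorant ε cs
minorant ε (suc _ ∷ cs) = powℚ ε (length cs)

module _ {ε} (0<ε : 0ℚ ℚ.< ε) where
  0≤ε : 0ℚ ℚ.≤ ε
  0≤ε = ℚ.<⇒≤ 0<ε

  0<powℚ : ∀ k → 0ℚ ℚ.< powℚ ε k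
  0<powℚ zero    = ℚ.positive⁻¹ 1ℚ
  0<powℚ (suc k) = 0<* 0<ε (0<powℚ k)

  0<minorant : ∀ cs → 0ℚ ℚ.< minorant ε cs
  0<minorant []           = ℚ.positive⁻¹ 1ℚ
  0<minorant (zero ∷ cs)  = 0<* 0<ε (0<minorant cs)
  0<minorant (suc _ ∷ cs) = 0<powℚ (length cs)

  module _ {a} (inside : InsideWith ε a) where
    open InsideWith inside
    open Solver using (solve; _:=_; _:+_; _:*_; _:-_; :-_; con)
    private point = real a

    x-1≥ε : AtLeast (⟦ x-1 ⟧ point) ε
    x-1≥ε = atLeast (solve 1 (λ z → con (ℤ.- (+ 1)) :+ z :* (con (+ 1) :+ z :* con (+ 0)) := z :- con (+ 1)) refl point)
      (subst (ℚ._≤ a ℚ.- 1ℚ) (+-*-Solver.solve 1 (λ e → S.con 1ℚ S.:+ e S.:- S.con 1ℚ S.:= e) refl ε) (ℚ.+-monoˡ-≤ (ℚ.- 1ℚ) above))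
      where module S = +-*-Solver

    2-x≥ε : AtLeast (⟦ 2-x ⟧ point) ε
    2-x≥ε = atLeast (solve 1 (λ z → con (+ 2) :+ z :* (con (ℤ.- (+ 1)) :+ z :* con (+ 0)) := con (+ 2) :- z) refl point)
      (subst (ℚ._≤ + 2 / 1 ℚ.- a) (+-*-Solver.solve 2 (λ a e → a S.:+ e S.:- a S.:= e) refl a ε) (ℚ.+-monoˡ-≤ (ℚ.- a) below))
      where module S = +-*-Solver

    1≤a : 1ℚ ℚ.≤ a
    1≤a = ℚ.≤-trans (p≤p+q 0≤ε) above

    power≥1 : ∀ i → AtLeast (power point i) 1ℚ
    power≥1 zero    = atLeast refl ℚ.≤-refl
    power≥1 (suc i) = atLeast-· 0≤1 0≤1 (atLeast refl 1≤a) (power≥1 i)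
      where 0≤1 = ℚ.<⇒≤ (ℚ.positive⁻¹ 1ℚ)

    2-x^≥ : ∀ k → AtLeast (⟦ 2-x ^ₚ k ⟧ point) (powℚ ε k)
    2-x^≥ zero    = atLeast (eval-const (+ 1) point) ℚ.≤-refl
    2-x^≥ (suc k) = subst (λ v → AtLeast v (powℚ ε (suc k))) (sym (eval-* 2-x (2-x ^ₚ k) point))
      (atLeast-· 0≤ε (ℚ.<⇒≤ (0<powℚ k)) 2-x≥ε (2-x^≥ k))

    bernstein-∷ : ∀ c cs {b d} → AtLeast (⟦ const (+ c) *ₚ (2-x ^ₚ length cs) ⟧ point) d →
      AtLeast (⟦ x-1 ⟧ point · ⟦ bernstein cs ⟧ point) b → AtLeast (⟦ bernstein (c ∷ cs) ⟧ point) (d ℚ.+ b)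
    bernstein-∷ c cs {b} {d} c≥ cs≥ = subst (λ v → AtLeast v (d ℚ.+ b))
      (sym (trans (eval-+ (const (+ c) *ₚ (2-x ^ₚ length cs)) (x-1 *ₚ bernstein cs) point)
        (cong (⟦ const (+ c) *ₚ (2-x ^ₚ length cs) ⟧ point ⊕_) (eval-* x-1 (bernstein cs) point))))
      (atLeast-⊕ c≥ cs≥)

    scaled≥ : ∀ c k {b} → b ℚ.≤ + c / 1 → 0ℚ ℚ.≤ b → AtLeast (⟦ const (+ c) *ₚ (2-x ^ₚ k) ⟧ point) (b ℚ.* powℚ ε k)
    scaled≥ c k {b} b≤c 0≤b = subst (λ v → AtLeast v (b ℚ.* powℚ ε k)) (sym (eval-* (const (+ c)) (2-x ^ₚ k) point))
      (atLeast-· 0≤b (ℚ.<⇒≤ (0<powℚ k)) (atLeast (eval-const (+ c) point) b≤c) (2-x^≥ k))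

    0≤/1 : ∀ c → 0ℚ ℚ.≤ + c / 1
    0≤/1 c = ℚ.nonNegative⁻¹ (+ c / 1) {{ℚ.normalize-nonNeg c 1}}

    bernstein≥0 : ∀ cs → AtLeast (⟦ bernstein cs ⟧ point) 0ℚ
    bernstein≥0 []       = atLeast refl ℚ.≤-refl
    bernstein≥0 (c ∷ cs) = atLeast-weaken (ℚ.+-mono-≤ (0≤* ℚ.≤-refl (ℚ.<⇒≤ (0<powℚ (length cs)))) (0≤* 0≤ε ℚ.≤-refl))
      (bernstein-∷ c cs (scaled≥ c (length cs) (0≤/1 c) ℚ.≤-refl) (atLeast-· 0≤ε ℚ.≤-refl x-1≥ε (bernstein≥0 cs)))

    bernstein≥minorant : ∀ cs → Positive cs → AtLeast (⟦ bernstein cs ⟧ point) (minorant ε cs)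
    bernstein≥minorant (zero ∷ cs) pos = atLeast-weaken (ℚ.≤-reflexive (sym (trans
        (cong (ℚ._+ minorant ε (zero ∷ cs)) (ℚ.*-zeroˡ (powℚ ε (length cs)))) (ℚ.+-identityˡ _))))
      (bernstein-∷ zero cs (scaled≥ zero (length cs) ℚ.≤-refl ℚ.≤-refl)
        (atLeast-· 0≤ε (ℚ.<⇒≤ (0<minorant cs)) x-1≥ε (bernstein≥minorant cs pos)))
    bernstein≥minorant (suc c ∷ cs) pos = atLeast-weaken (ℚ.≤-reflexive (sym (trans
        (cong₂ ℚ._+_ (ℚ.*-identityˡ (powℚ ε (length cs))) (ℚ.*-zeroʳ ε)) (ℚ.+-identityʳ _))))
      (bernstein-∷ (suc c) cs (scaled≥ (suc c) (length cs) {b = 1ℚ} 1≤c (ℚ.<⇒≤ (ℚ.positive⁻¹ 1ℚ)))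
        (atLeast-· 0≤ε ℚ.≤-refl x-1≥ε (bernstein≥0 cs)))
      where
      1≤c : 1ℚ ℚ.≤ + suc c / 1
      1≤c = subst (1ℚ ℚ.≤_) (sym (/1-+ (+ 1) (+ c))) (p≤p+q (0≤/1 c))

-- Sums of coefficient lists keep their zeros, so a polynomial identity is tested coefficientwise
-- and not as equality with the empty list.
IsZero : ℤ[x] → Set
IsZero p = True (all? (ℤ._≟ ℤ.0ℤ) p)

eval-zero : ∀ {p} → All (_≡ ℤ.0ℤ) p → ∀ z → ⟦ p ⟧ z ≡ real 0ℚ
eval-zero []         z = refl
eval-zero (refl ∷ p) z = trans (cong (λ v → real 0ℚ ⊕ z · v) (eval-zero p z))
  (solve 1 (λ z → con (+ 0) :+ z :* con (+ 0) := con (+ 0)) refl z)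
  where open Solver using (solve; _:=_; _:+_; _:*_; con)

-- Every root of p in (1,2) is a root of some, possibly different, polynomial without small roots.

Admissible : ℤ[x] → Set
Admissible p = ∀ {q} → Inside q → Bounded (λ n → real (q n)) → NullAt p (λ n → real (q n)) →
  ∃[ p′ ] NullAt p′ (λ n → real (q n)) × Avoids p′

avoids⇒admissible : ∀ {p} → Avoids p → Admissible p
avoids⇒admissible {p} p-avoids _ _ q₀ = p , q₀ , p-avoids

-- With the Bernstein forms b₁ ≥ 0 and b₂ > 0, the hypotheses say that - m p = (xⁱ - 1) b₁ + b₂,
-- which is positive on (1,2); so p is admissible for want of roots.

no-root⇒admissible : ∀ {m i p p₀ p₁} → Split m i p p₀ p₁ → ∀ cs₁ cs₂ → Positive cs₂ →
  IsZero (p₁ +ₚ bernstein cs₁) → IsZero (p₀ +ₚ p₁ +ₚ bernstein cs₂) → Admissible p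
no-root⇒admissible {m} {i} {p} {p₀} {p₁} p-split cs₁ cs₂ pos b₁-eq b₂-eq {q} (ε , 0<ε , q-inside) q-bounded q₀ =
  let 0<δ = 0<minorant 0<ε cs₂ in
  ⊥-elim (eventually-¬⊥ (eventually-zip (λ n → absurd 0<ε) q-inside
    (null-neg (null-multiple m p q-bounded q₀) (½ ℚ.* minorant ε cs₂) (0<* 0<½ 0<δ))))
  where
  open Solver using (solve; _:=_; _:+_; _:*_; _:-_; :-_; con)
  expand : ∀ z → ⊖ (⟦ m ⟧ z · ⟦ p ⟧ z) ≡ (power z i ⊕ ⊖ real 1ℚ) · ⟦ bernstein cs₁ ⟧ z ⊕ ⟦ bernstein cs₂ ⟧ z
  expand z = begin
    ⊖ (⟦ m ⟧ z · ⟦ p ⟧ z)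
      ≡⟨ cong ⊖_ (identity p-split z) ⟩
    ⊖ (⟦ p₀ ⟧ z ⊕ power z i · ⟦ p₁ ⟧ z)
      -- The two subtracted combinations vanish by `b₁-eq` and `b₂-eq`.
      ≡⟨ solve 5 (λ w p₀ p₁ b₁ b₂ → :- (p₀ :+ w :* p₁) := (w :- con (+ 1)) :* b₁ :+ b₂
           :- ((w :- con (+ 1)) :* (p₁ :+ b₁) :+ (p₀ :+ p₁ :+ b₂))) refl
           (power z i) (⟦ p₀ ⟧ z) (⟦ p₁ ⟧ z) b₁ b₂ ⟩
    (power z i ⊕ ⊖ real 1ℚ) · b₁ ⊕ b₂ ⊕ ⊖ ((power z i ⊕ ⊖ real 1ℚ) · (⟦ p₁ ⟧ z ⊕ b₁) ⊕ (⟦ p₀ ⟧ z ⊕ ⟦ p₁ ⟧ z ⊕ b₂))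
      ≡⟨ cong₂ (λ u v → (power z i ⊕ ⊖ real 1ℚ) · b₁ ⊕ b₂ ⊕ ⊖ ((power z i ⊕ ⊖ real 1ℚ) · u ⊕ v))
           (trans (sym (eval-+ p₁ (bernstein cs₁) z)) (eval-zero (toWitness b₁-eq) z))
           (trans (sym (trans (eval-+ (p₀ +ₚ p₁) (bernstein cs₂) z) (cong (_⊕ b₂) (eval-+ p₀ p₁ z)))) (eval-zero (toWitness b₂-eq) z)) ⟩
    (power z i ⊕ ⊖ real 1ℚ) · b₁ ⊕ b₂ ⊕ ⊖ ((power z i ⊕ ⊖ real 1ℚ) · real 0ℚ ⊕ real 0ℚ)
      ≡⟨ solve 3 (λ w b₁ b₂ → (w :- con (+ 1)) :* b₁ :+ b₂ :- ((w :- con (+ 1)) :* con (+ 0) :+ con (+ 0))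
           := (w :- con (+ 1)) :* b₁ :+ b₂) refl (power z i) b₁ b₂ ⟩
    (power z i ⊕ ⊖ real 1ℚ) · b₁ ⊕ b₂ ∎
    where
    open ≡-Reasoning
    b₁ = ⟦ bernstein cs₁ ⟧ z
    b₂ = ⟦ bernstein cs₂ ⟧ z
  absurd : ∀ {ε a} (0<ε : 0ℚ ℚ.< ε) → InsideWith ε a →
    ¬ Bound (⊖ (⟦ m ⟧ (real a) · ⟦ p ⟧ (real a))) (½ ℚ.* minorant ε cs₂)
  absurd {ε} {a} 0<ε inside small = ℚ.<-irrefl refl (begin-strict
    δ                      ≡⟨ trans (cong (ℚ._+ δ) (ℚ.*-zeroˡ 0ℚ)) (ℚ.+-identityˡ δ) ⟨
    0ℚ ℚ.* 0ℚ ℚ.+ δ        ≤⟨ AtLeast.lower large ⟩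
    AtLeast.part large     ≤⟨ p≤∣p∣ (AtLeast.part large) ⟩
    ∣ AtLeast.part large ∣ ≤⟨ bound-real⁻¹ (subst (λ v → Bound v (½ ℚ.* δ)) (trans (expand z) (AtLeast.isReal large)) small) ⟩
    ½ ℚ.* δ                <⟨ half<1 (0<minorant 0<ε cs₂) ⟩
    δ                      ∎)
    where
    open ℚ.≤-Reasoning
    z = real a
    δ = minorant ε cs₂
    large : AtLeast ((power z i ⊕ ⊖ real 1ℚ) · ⟦ bernstein cs₁ ⟧ z ⊕ ⟦ bernstein cs₂ ⟧ z) (0ℚ ℚ.* 0ℚ ℚ.+ δ)
    large = atLeast-⊕
      -- The lower bound for xⁱ - 1 is 1 + (- 1), which computes to 0.
      (atLeast-· ℚ.≤-refl ℚ.≤-refl (atLeast-⊕ (power≥1 0<ε inside i) (atLeast {part = ℚ.- 1ℚ} refl ℚ.≤-refl)) (bernstein≥0 0<ε inside cs₁))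
      (bernstein≥minorant 0<ε inside cs₂ pos)

-- The families of regular polynomials

-- The preceding criterion wants m p negative on (1,2); the multiplier - 1 serves a polynomial that
-- is positive there.
split-neg : ∀ f → Split (const (ℤ.- (+ 1))) 0 f (-ₚ f) []
split-neg f = split λ z → trans (cong₂ _·_ (eval-const (ℤ.- (+ 1)) z) refl)
  (trans (solve 1 (λ f → con (ℤ.- (+ 1)) :* f := :- f :+ con (+ 1) :* con (+ 0)) refl (⟦ f ⟧ z))
    (cong (_⊕ real 1ℚ · real 0ℚ) (sym (eval-neg f z))))
  where open Solver using (solve; _:=_; _:+_; _:*_; :-_; con)

-- Eventually q is at least 1, so removing the factor q enlarges nothing.
null-cancel-x : ∀ {q} → Inside q → ∀ {t} → Null (λ n → real (q n) · t n) → Null t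
null-cancel-x {q} (ε , 0<ε , q-inside) {t} qt₀ β 0<β = eventually-zip cancel q-inside (qt₀ β 0<β)
  where
  open ℚ.≤-Reasoning
  cancel : ∀ n → InsideWith ε (q n) → Bound (real (q n) · t n) β → Bound (t n) β
  cancel n inside (0≤β , qt≤) = 0≤β , (begin
    norm (t n)                        ≡⟨ ℚ.*-identityˡ (norm (t n)) ⟨
    1ℚ ℚ.* norm (t n)                 ≤⟨ *-mono-≤ (0≤norm z) (0≤norm (t n)) 1≤z ℚ.≤-refl ⟩
    norm z ℚ.* norm (t n)             ≡⟨ norm-· z (t n) ⟨
    norm (z · t n)                    ≤⟨ qt≤ ⟩
    β ℚ.* β                           ∎)
    where
    z = real (q n)
    1≤z : 1ℚ ℚ.≤ norm z
    1≤z = subst (1ℚ ℚ.≤_) (sym (norm-real (q n)))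
      (Sqrt-Facts.square-mono (ℚ.<⇒≤ (ℚ.positive⁻¹ 1ℚ)) (1≤a 0<ε inside))

-- As Φ₁ = Ψ₁, the polynomials (x² - x - 1) xⁿ ± 1 also arise from the family Φ_A with r = 1, once a
-- factor x is removed.
Ψ-B₁-avoids : ∀ n s → 1 ℕ.≤ n → Avoids (Ψ 1 *ₚ x^ n ±[ s ] geometric 1)
Ψ-B₁-avoids 1             Sign.+ _ = avoids-fixed (split-trivial (Ψ 1)) (split-trivial (geometric 1)) 1 Sign.+ _
Ψ-B₁-avoids 1             Sign.- _ = avoids-fixed (split-trivial (Ψ 1)) (split-trivial (geometric 1)) 1 Sign.- _
Ψ-B₁-avoids (suc (suc j)) s      _ = avoids-beyond (split-trivial (Ψ 1)) (split-trivial (geometric 1)) 2 j s _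

-- For r = 1 the correction term of the family Φ_A is x, and a factor x splits off.

Φ-A₁-admissible : ∀ j s → Admissible (Φ 1 *ₚ x^ (2 ℕ.+ j) ±[ s ] (x^ 1 -ₚ x^ 0 +ₚ const (+ 1)))
Φ-A₁-admissible j s {q} q-inside _ q₀ = Ψ 1 *ₚ x^ (suc j) ±[ s ] geometric 1 ,
  null-cancel-x q-inside (null-cong (λ n → factor (real (q n)) s) q₀) ,
  Ψ-B₁-avoids (suc j) s (s≤s ℕ.z≤n)
  where
  open Solver using (solve; _:=_; _:+_; _:*_; _:-_; :-_; con)
  P : Sign → ℤ[x]
  P s = Φ 1 *ₚ x^ (2 ℕ.+ j) ±[ s ] (x^ 1 -ₚ x^ 0 +ₚ const (+ 1))
  factor : ∀ z s → ⟦ P s ⟧ z ≡ z · ⟦ Ψ 1 *ₚ x^ (suc j) ±[ s ] geometric 1 ⟧ z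
  factor z s = begin
    ⟦ P s ⟧ z
      ≡⟨ eval-± s (Φ 1 *ₚ x^ (2 ℕ.+ j)) (x^ 1 -ₚ x^ 0 +ₚ const (+ 1)) z ⟩
    ⟦ Φ 1 *ₚ x^ (2 ℕ.+ j) ⟧ z ⊕ signed s ⟦Q⟧
      ≡⟨ cong (_⊕ signed s ⟦Q⟧) (trans (eval-* (Φ 1) (x^ (2 ℕ.+ j)) z) (cong (⟦ Φ 1 ⟧ z ·_) (eval-x^ (2 ℕ.+ j) z))) ⟩
    ⟦ Φ 1 ⟧ z · (z · (z · power z j)) ⊕ signed s ⟦Q⟧
      ≡⟨ pull s ⟩
    z · (⟦ Φ 1 ⟧ z · (z · power z j) ⊕ signed s (⟦ geometric 1 ⟧ z))
      ≡⟨ cong (λ u → z · (u ⊕ signed s (⟦ geometric 1 ⟧ z)))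
           (trans (eval-* (Ψ 1) (x^ (suc j)) z) (cong (⟦ Φ 1 ⟧ z ·_) (eval-x^ (suc j) z))) ⟨
    z · (⟦ Ψ 1 *ₚ x^ (suc j) ⟧ z ⊕ signed s (⟦ geometric 1 ⟧ z))
      ≡⟨ cong (z ·_) (eval-± s (Ψ 1 *ₚ x^ (suc j)) (geometric 1) z) ⟨
    z · ⟦ Ψ 1 *ₚ x^ (suc j) ±[ s ] geometric 1 ⟧ z ∎
    where
    open ≡-Reasoning
    ⟦Q⟧ = ⟦ x^ 1 -ₚ x^ 0 +ₚ const (+ 1) ⟧ z
    pull : ∀ s → ⟦ Φ 1 ⟧ z · (z · (z · power z j)) ⊕ signed s (⟦ x^ 1 -ₚ x^ 0 +ₚ const (+ 1) ⟧ z)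
      ≡ z · (⟦ Ψ 1 ⟧ z · (z · power z j) ⊕ signed s (⟦ geometric 1 ⟧ z))
    pull Sign.+ = solve 3 (λ f z w → f :* (z :* (z :* w)) :+ (con (+ 0) :+ z :* (con (+ 1) :+ z :* con (+ 0)))
      := z :* (f :* (z :* w) :+ (con (+ 1) :+ z :* con (+ 0)))) refl (⟦ Φ 1 ⟧ z) z (power z j)
    pull Sign.- = solve 3 (λ f z w → f :* (z :* (z :* w)) :- (con (+ 0) :+ z :* (con (+ 1) :+ z :* con (+ 0)))
      := z :* (f :* (z :* w) :- (con (+ 1) :+ z :* con (+ 0)))) refl (⟦ Φ 1 ⟧ z) z (power z j)

-- A certificate for variable r uses only that xⁱ is at most 1 in absolute value, which is crude;
-- small r are therefore often taken singly, with exact coefficients.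
Ψ-B-admissible : ∀ r n s → 1 ℕ.≤ r → 1 ℕ.≤ n → Admissible (Ψ r *ₚ x^ n ±[ s ] geometric r)
Ψ-B-admissible 1 n s _ 1≤n = avoids⇒admissible (Ψ-B₁-avoids n s 1≤n)
Ψ-B-admissible (suc (suc i)) 1 Sign.+ _ _ =
  avoids⇒admissible (avoids-fixed (Ψ-split 2 i) (Ψ-B-split 2 i) 1 Sign.+ _)
-- The polynomial x⁴ - x³ - x² - 2x - 1 has a root between - 0.6 and - 0.5, but is negative on
-- (1,2).
Ψ-B-admissible 2 1 Sign.- _ _ = no-root⇒admissible
  (split-trivial (Ψ 2 *ₚ x^ 1 -ₚ geometric 2)) [] (4 ∷ 19 ∷ 31 ∷ 18 ∷ 1 ∷ []) _ _ _
Ψ-B-admissible 3 1 Sign.- _ _ = avoids⇒admissible (avoids-fixed (split-trivial (Ψ 3)) (split-trivial (geometric 3)) 1 Sign.- _)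
Ψ-B-admissible (suc (suc (suc (suc i)))) 1 Sign.- _ _ =
  avoids⇒admissible (avoids-fixed (Ψ-split 4 i) (Ψ-B-split 4 i) 1 Sign.- _)
-- The polynomial is (x² - x - 1)(x³ - 1); both sides compute to the same coefficient list.
Ψ-B-admissible 2 2 Sign.+ _ _ = avoids⇒admissible
  (avoids-golden-* (x^ 3 -ₚ const (+ 1)) (avoids-split (split-trivial (x^ 3 -ₚ const (+ 1))) _))
Ψ-B-admissible (suc (suc (suc i))) 2 Sign.+ _ _ =
  avoids⇒admissible (avoids-fixed (Ψ-split 3 i) (Ψ-B-split 3 i) 2 Sign.+ _)
Ψ-B-admissible (suc (suc i)) 2 Sign.- _ _ =
  avoids⇒admissible (avoids-fixed (Ψ-split 2 i) (Ψ-B-split 2 i) 2 Sign.- _)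
Ψ-B-admissible (suc (suc i)) (suc (suc (suc j))) s _ _ =
  avoids⇒admissible (avoids-beyond (Ψ-split 2 i) (Ψ-B-split 2 i) 3 j s _)

Φ-A-admissible : ∀ r n s → 1 ℕ.≤ r → 1 ℕ.≤ n →
  Admissible (Φ r *ₚ x^ n ±[ s ] (x^ r -ₚ x^ (r ℕ.∸ 1) +ₚ const (+ 1)))
-- Here the polynomial is x²(x - 1), and for the other sign x(x - 2)(x + 1). Neither vanishes
-- strictly between 1 and 2.
Φ-A-admissible 1 1 Sign.+ _ _ = no-root⇒admissible
  (split-neg (Φ 1 *ₚ x^ 1 +ₚ (x^ 1 -ₚ x^ 0 +ₚ const (+ 1)))) [] (0 ∷ 1 ∷ 4 ∷ 4 ∷ []) _ _ _
Φ-A-admissible 1 1 Sign.- _ _ = no-root⇒admissible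
  (split-trivial (Φ 1 *ₚ x^ 1 -ₚ (x^ 1 -ₚ x^ 0 +ₚ const (+ 1)))) [] (2 ∷ 7 ∷ 6 ∷ 0 ∷ []) _ _ _
Φ-A-admissible 1 (suc (suc j)) s _ _ = Φ-A₁-admissible j s
-- The lists are the Bernstein coefficients of - p₁ and of - (p₀ + p₁), the latter being the case i
-- = 0.
Φ-A-admissible (suc (suc i)) 1 Sign.- _ _ = no-root⇒admissible (split-± (Φ-split 2 i) (Φ-A-split 1 i) 1 Sign.-)
  (1 ∷ 7 ∷ 16 ∷ 13 ∷ 2 ∷ []) (2 ∷ 10 ∷ 18 ∷ 12 ∷ 1 ∷ []) _ _ _
Φ-A-admissible 2 1 Sign.+ _ _ = avoids⇒admissible
  (avoids-fixed (split-trivial (Φ 2)) (split-trivial (x^ 2 -ₚ x^ 1 +ₚ const (+ 1))) 1 Sign.+ _)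
Φ-A-admissible (suc (suc (suc i))) 1 Sign.+ _ _ =
  avoids⇒admissible (avoids-fixed (Φ-split 3 i) (Φ-A-split 2 i) 1 Sign.+ _)
Φ-A-admissible 2 (suc (suc j)) s _ _ = avoids⇒admissible
  (avoids-beyond (split-trivial (Φ 2)) (split-trivial (x^ 2 -ₚ x^ 1 +ₚ const (+ 1))) 2 j s _)
-- The cofactor of x² - x - 1 is (x - 1)(x³ + 1), with only roots of unity as roots.
Φ-A-admissible 3 2 Sign.+ _ _ = avoids⇒admissible
  (avoids-golden-* (x^ 4 -ₚ x^ 3 +ₚ x^ 1 -ₚ const (+ 1)) (avoids-split (split-trivial (x^ 4 -ₚ x^ 3 +ₚ x^ 1 -ₚ const (+ 1))) _))
Φ-A-admissible 3 2 Sign.- _ _ = avoids⇒admissible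
  (avoids-fixed (split-trivial (Φ 3)) (split-trivial (x^ 3 -ₚ x^ 2 +ₚ const (+ 1))) 2 Sign.- _)
Φ-A-admissible 3 (suc (suc (suc j))) s _ _ = avoids⇒admissible
  (avoids-beyond (split-trivial (Φ 3)) (split-trivial (x^ 3 -ₚ x^ 2 +ₚ const (+ 1))) 3 j s _)
Φ-A-admissible (suc (suc (suc (suc i)))) 2 Sign.+ _ _ =
  avoids⇒admissible (avoids-fixed (Φ-split 4 i) (Φ-A-split 3 i) 2 Sign.+ _)
Φ-A-admissible (suc (suc (suc (suc i)))) 2 Sign.- _ _ =
  avoids⇒admissible (avoids-fixed (Φ-split 4 i) (Φ-A-split 3 i) 2 Sign.- _)
Φ-A-admissible (suc (suc (suc (suc i)))) (suc (suc (suc j))) s _ _ =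
  avoids⇒admissible (avoids-beyond (Φ-split 4 i) (Φ-A-split 3 i) 3 j s _)

Φ-B-avoids : ∀ r n s → 1 ℕ.≤ r → 1 ℕ.≤ n → Avoids (Φ r *ₚ x^ n ±[ s ] (x^ r -ₚ x^ 1 +ₚ const (+ 1)))
Φ-B-avoids (suc i) 1 Sign.+ _ _ = avoids-fixed (Φ-split 1 i) (Φ-B-split 1 i) 1 Sign.+ _
Φ-B-avoids 1 1 Sign.- _ _ = avoids-fixed (split-trivial (Φ 1)) (split-trivial (x^ 1 -ₚ x^ 1 +ₚ const (+ 1))) 1 Sign.- _
Φ-B-avoids 2 1 Sign.- _ _ = avoids-fixed (split-trivial (Φ 2)) (split-trivial (x^ 2 -ₚ x^ 1 +ₚ const (+ 1))) 1 Sign.- _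
Φ-B-avoids (suc (suc (suc i))) 1 Sign.- _ _ = avoids-fixed (Φ-split 3 i) (Φ-B-split 3 i) 1 Sign.- _
Φ-B-avoids 1 (suc (suc j)) s _ _ =
  avoids-beyond (split-trivial (Φ 1)) (split-trivial (x^ 1 -ₚ x^ 1 +ₚ const (+ 1))) 2 j s _
Φ-B-avoids 2 (suc (suc j)) s _ _ =
  avoids-beyond (split-trivial (Φ 2)) (split-trivial (x^ 2 -ₚ x^ 1 +ₚ const (+ 1))) 2 j s _
Φ-B-avoids 3 (suc (suc j)) s _ _ =
  avoids-beyond (split-trivial (Φ 3)) (split-trivial (x^ 3 -ₚ x^ 1 +ₚ const (+ 1))) 2 j s _
Φ-B-avoids (suc (suc (suc (suc i)))) (suc (suc j)) s _ _ = avoids-beyond (Φ-split 4 i) (Φ-B-split 4 i) 2 j s _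

Φ-C-admissible : ∀ r n s → 1 ℕ.≤ r → 1 ℕ.≤ n →
  Admissible (Φ r *ₚ x^ n ±[ s ] ((x^ r +ₚ const (+ 1)) *ₚ (x^ 1 -ₚ const (+ 1))))
Φ-C-admissible 1 1 Sign.+ _ _ = avoids⇒admissible
  (avoids-fixed (split-trivial (Φ 1)) (split-trivial ((x^ 1 +ₚ const (+ 1)) *ₚ x-1)) 1 Sign.+ _)
Φ-C-admissible (suc (suc i)) 1 Sign.+ _ _ =
  avoids⇒admissible (avoids-fixed (Φ-split 2 i) (Φ-C-split 2 i) 1 Sign.+ _)
Φ-C-admissible (suc i) 1 Sign.- _ _ = no-root⇒admissible (split-± (Φ-split 1 i) (Φ-C-split 1 i) 1 Sign.-)
  (1 ∷ 5 ∷ 7 ∷ 2 ∷ []) (1 ∷ 5 ∷ 6 ∷ 1 ∷ []) _ _ _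
Φ-C-admissible 1 (suc (suc j)) s _ _ = avoids⇒admissible
  (avoids-beyond (split-trivial (Φ 1)) (split-trivial ((x^ 1 +ₚ const (+ 1)) *ₚ x-1)) 2 j s _)
Φ-C-admissible 2 (suc (suc j)) s _ _ = avoids⇒admissible
  (avoids-beyond (split-trivial (Φ 2)) (split-trivial ((x^ 2 +ₚ const (+ 1)) *ₚ x-1)) 2 j s _)
Φ-C-admissible (suc (suc (suc i))) (suc (suc j)) s _ _ =
  avoids⇒admissible (avoids-beyond (Φ-split 3 i) (Φ-C-split 3 i) 2 j s _)

Ψ-A-admissible : ∀ r n s → 1 ℕ.≤ r → 1 ℕ.≤ n → Admissible (Ψ r *ₚ x^ n ±[ s ] (x^ (suc r) -ₚ const (+ 1)))
Ψ-A-admissible (suc i) 1 Sign.+ _ _ = avoids⇒admissible (avoids-fixed (Ψ-split 1 i) (Ψ-A-split 1 i) 1 Sign.+ _)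
-- The second list starts with 0 because the multiplier x - 1 brings in a zero at 1.
Ψ-A-admissible (suc i) 1 Sign.- _ _ = no-root⇒admissible (split-± (Ψ-split 1 i) (Ψ-A-split 1 i) 1 Sign.-)
  (1 ∷ 7 ∷ 17 ∷ 16 ∷ 4 ∷ []) (0 ∷ 1 ∷ 5 ∷ 6 ∷ 1 ∷ []) _ _ _
Ψ-A-admissible (suc i) 2 Sign.+ _ _ = avoids⇒admissible (avoids-fixed (Ψ-split 1 i) (Ψ-A-split 1 i) 2 Sign.+ _)
Ψ-A-admissible 1 2 Sign.- _ _ = avoids⇒admissible
  (avoids-fixed (split-trivial (Ψ 1)) (split-trivial (x^ 2 -ₚ const (+ 1))) 2 Sign.- _)
Ψ-A-admissible (suc (suc i)) 2 Sign.- _ _ = no-root⇒admissible (split-± (Ψ-split 2 i) (Ψ-A-split 2 i) 2 Sign.-)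
  (1 ∷ 11 ∷ 48 ∷ 105 ∷ 118 ∷ 60 ∷ 8 ∷ []) (0 ∷ 2 ∷ 17 ∷ 51 ∷ 67 ∷ 35 ∷ 3 ∷ []) _ _ _
Ψ-A-admissible 1 (suc (suc (suc j))) s _ _ = avoids⇒admissible
  (avoids-beyond (split-trivial (Ψ 1)) (split-trivial (x^ 2 -ₚ const (+ 1))) 3 j s _)
Ψ-A-admissible 2 (suc (suc (suc j))) s _ _ = avoids⇒admissible
  (avoids-beyond (split-trivial (Ψ 2)) (split-trivial (x^ 3 -ₚ const (+ 1))) 3 j s _)
Ψ-A-admissible (suc (suc (suc i))) (suc (suc (suc j))) s _ _ =
  avoids⇒admissible (avoids-beyond (Ψ-split 3 i) (Ψ-A-split 3 i) 3 j s _)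

Χ-A-admissible : ∀ n s → 1 ℕ.≤ n → Admissible (Χ *ₚ x^ n ±[ s ] (x^ 3 +ₚ x^ 2 -ₚ x^ 1 -ₚ const (+ 1)))
Χ-A-admissible 1 Sign.+ _ = avoids⇒admissible
  (avoids-fixed (split-trivial Χ) (split-trivial (x^ 3 +ₚ x^ 2 -ₚ x^ 1 -ₚ const (+ 1))) 1 Sign.+ _)
Χ-A-admissible 1 Sign.- _ = no-root⇒admissible
  (split-trivial (Χ *ₚ x^ 1 -ₚ (x^ 3 +ₚ x^ 2 -ₚ x^ 1 -ₚ const (+ 1)))) [] (1 ∷ 13 ∷ 48 ∷ 73 ∷ 45 ∷ 7 ∷ []) _ _ _
-- The cofactor x⁴ - x² + 1 is the twelfth cyclotomic polynomial.
Χ-A-admissible 2 Sign.+ _ = avoids⇒admissible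
  (avoids-golden-* (x^ 4 -ₚ x^ 2 +ₚ const (+ 1)) (avoids-split (split-trivial (x^ 4 -ₚ x^ 2 +ₚ const (+ 1))) _))
Χ-A-admissible 2 Sign.- _ = avoids⇒admissible
  (avoids-fixed (split-trivial Χ) (split-trivial (x^ 3 +ₚ x^ 2 -ₚ x^ 1 -ₚ const (+ 1))) 2 Sign.- _)
Χ-A-admissible (suc (suc (suc j))) s _ = avoids⇒admissible
  (avoids-beyond (split-trivial Χ) (split-trivial (x^ 3 +ₚ x^ 2 -ₚ x^ 1 -ₚ const (+ 1))) 3 j s _)

Χ-B-avoids : ∀ n s → 1 ℕ.≤ n → Avoids (Χ *ₚ x^ n ±[ s ] (x^ 4 -ₚ x^ 2 +ₚ const (+ 1)))
Χ-B-avoids 1 Sign.+ _ = avoids-fixed (split-trivial Χ) (split-trivial (x^ 4 -ₚ x^ 2 +ₚ const (+ 1))) 1 Sign.+ _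
Χ-B-avoids 1 Sign.- _ = avoids-fixed (split-trivial Χ) (split-trivial (x^ 4 -ₚ x^ 2 +ₚ const (+ 1))) 1 Sign.- _
Χ-B-avoids (suc (suc j)) s _ = avoids-beyond (split-trivial Χ) (split-trivial (x^ 4 -ₚ x^ 2 +ₚ const (+ 1))) 2 j s _

regular-admissible : ∀ {p} → RegularPolynomial p → Admissible p
regular-admissible (Φ-A {r} {n} s 1≤r 1≤n) = Φ-A-admissible r n s 1≤r 1≤n
regular-admissible (Φ-B {r} {n} s 1≤r 1≤n) = avoids⇒admissible (Φ-B-avoids r n s 1≤r 1≤n)
regular-admissible (Φ-C {r} {n} s 1≤r 1≤n) = Φ-C-admissible r n s 1≤r 1≤n
regular-admissible (Ψ-A {r} {n} s 1≤r 1≤n) = Ψ-A-admissible r n s 1≤r 1≤n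
regular-admissible (Ψ-B {r} {n} s 1≤r 1≤n) = Ψ-B-admissible r n s 1≤r 1≤n
regular-admissible (Χ-A {n} s 1≤n)         = Χ-A-admissible n s 1≤n
regular-admissible (Χ-B {n} s 1≤n)         = avoids⇒admissible (Χ-B-avoids n s 1≤n)

limit-avoids : ∀ {p} → LimitPolynomial p → Avoids p
limit-avoids (Φ-limit {1} _)                 = golden-avoids
limit-avoids (Φ-limit {2} _)                 = avoids-split (split-trivial (Φ 2)) _
limit-avoids (Φ-limit {suc (suc (suc i))} _) = avoids-split (Φ-split 3 i) _
-- Ψ₁ and Φ₁ have the same coefficient list.
limit-avoids (Ψ-limit {1} _)                 = golden-avoids
limit-avoids (Ψ-limit {suc (suc i)} _)       = avoids-split (Ψ-split 2 i) _
limit-avoids Χ-limit                         = avoids-split (split-trivial Χ) _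

-- The lower bound

-- Minimality speaks of roots, whereas the reduction produces null sequences. Bounding by half of ε
-- yields the strict inequality.
null⇒root : ∀ p z → NullOn p (at z) → IsRoot p z
null⇒root p z p₀ = (λ ε 0<ε → eventually-map (λ n → part₁ 0<ε) (small 0<ε))
                 , (λ ε 0<ε → eventually-map (λ n → part₂ 0<ε) (small 0<ε))
  where
  open ℚ.≤-Reasoning
  open +-*-Solver using (solve; _:=_; _:-_; con)
  small : ∀ {ε} → 0ℚ ℚ.< ε → Eventually (λ n → Bound (at (eval p z) n) (½ ℚ.* ε))
  small {ε} 0<ε = eventually-map (λ n → subst (λ w → Bound w (½ ℚ.* ε)) (sym (at-eval p z n))) (p₀ (½ ℚ.* ε) (0<* 0<½ 0<ε))
  close-0 : ∀ {a ε} → 0ℚ ℚ.< ε → a ℚ.* a ℚ.≤ ½ ℚ.* ε ℚ.* (½ ℚ.* ε) → ∣ a ℚ.- 0ℚ ∣ ℚ.< ε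
  close-0 {a} {ε} 0<ε a²≤ = begin-strict
    ∣ a ℚ.- 0ℚ ∣    ≡⟨ cong ∣_∣ (solve 1 (λ a → a :- con 0ℚ := a) refl a) ⟩
    ∣ a ∣           ≤⟨ square-cancel-≤ (ℚ.<⇒≤ (0<* 0<½ 0<ε)) (subst (ℚ._≤ _) (sym (∣p∣²≡p² a)) a²≤) ⟩
    ½ ℚ.* ε         <⟨ half<1 0<ε ⟩
    ε               ∎
  part₁ : ∀ {a b ε} → 0ℚ ℚ.< ε → Bound (a , b) (½ ℚ.* ε) → ∣ a ℚ.- 0ℚ ∣ ℚ.< ε
  part₁ {a} {b} 0<ε (_ , ≤) = close-0 {a} 0<ε (ℚ.≤-trans (p≤p+q (0≤square b)) ≤)
  part₂ : ∀ {a b ε} → 0ℚ ℚ.< ε → Bound (a , b) (½ ℚ.* ε) → ∣ b ℚ.- 0ℚ ∣ ℚ.< ε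
  part₂ {a} {b} 0<ε (_ , ≤) = close-0 {b} 0<ε (ℚ.≤-trans
    (subst (b ℚ.* b ℚ.≤_) (ℚ.+-comm (b ℚ.* b) (a ℚ.* a)) (p≤p+q (0≤square a))) ≤)

-- The minimal polynomial is null along both q and z, so `null-transfer` applies; dropping the
-- leading 1 shortens both lists in the minimality condition by one.
conjugate-null : ∀ q z → GaloisConjugate q z → ∀ f → NullAt f (λ n → real (seq q n)) → NullAt f (at z)
conjugate-null q z (.(cs ∷ʳ 1ℚ) , ((cs , refl) , q-root , minimal) , z-root) f fq₀ =
  null-cong (λ n → evalAt-ℤ⇒ℚ f (at z n))
    (null-transfer (at (fromℝ q)) (at z) (bounded-at (fromℝ q)) (bounded-at z) cs
      (root⇒null (cs ∷ʳ 1ℚ) (fromℝ q) q-root) (root⇒null (cs ∷ʳ 1ℚ) z z-root) minimal′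
      (length (ℤ⇒ℚ f)) (ℤ⇒ℚ f) ℕ.≤-refl (null-cong (λ n → sym (evalAt-ℤ⇒ℚ f (real (seq q n)))) fq₀))
  where
  minimal′ : ∀ g → NullOn (g ∷ʳ 1ℚ) (at (fromℝ q)) → length cs ℕ.≤ length g
  minimal′ g g₀ = ℕ.≤-pred (subst₂ ℕ._≤_ (length-∷ʳ cs 1ℚ) (length-∷ʳ g 1ℚ)
    (minimal (g ∷ʳ 1ℚ) (g , refl) (null⇒root (g ∷ʳ 1ℚ) (fromℝ q) g₀)))

inside-⟨1,2⟩ : ∀ q → 1ᴿ <ᴿ q → q <ᴿ fromℚ (+ 2 / 1) → Inside (seq q)
inside-⟨1,2⟩ q (ε , 0<ε , M , 1<q) (δ , 0<δ , N , q<2) = ε ℚ.⊓ δ , 0<⊓ ,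
  eventually-zip (λ n 1+ε≤q q+δ≤2 → ℚ.≤-trans (ℚ.+-monoʳ-≤ 1ℚ (ℚ.p⊓q≤p ε δ)) 1+ε≤q
                                  , ℚ.≤-trans (ℚ.+-monoʳ-≤ (seq q n) (ℚ.p⊓q≤q ε δ)) q+δ≤2)
    (M , 1<q) (N , q<2)
  where
  0<⊓ : 0ℚ ℚ.< ε ℚ.⊓ δ
  0<⊓ with ℚ.⊓-sel ε δ
  ... | inj₁ eq = subst (0ℚ ℚ.<_) (sym eq) 0<ε
  ... | inj₂ eq = subst (0ℚ ℚ.<_) (sym eq) 0<δ

√5 : ℕ → ℚ
√5 n = sqrtApprox n (+ 5 / 1)

-- If r² ≤ 5 and 2T + 1 < r, then 4(T² + T) + 1 = (2T + 1)² < 5.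
below-√5 : ∀ n {T} → 0ℚ ℚ.≤ T → T ℚ.< (√5 n ℚ.- 1ℚ) ℚ.* ½ → T ℚ.* T ℚ.+ T ℚ.< 1ℚ
below-√5 n {T} 0≤T T<g = ℚ.≰⇒> λ 1≤T²+T → case-below 1≤T²+T (Sqrt-Facts.IsApprox.below approx)
  where
  open ℚ.≤-Reasoning
  open +-*-Solver using (solve; _:=_; _:+_; _:*_; _:-_; con)
  approx = Sqrt-Facts.sqrtApprox-approx n (+ 5 / 1)
  r u : ℚ
  r = √5 n
  u = T ℚ.+ T ℚ.+ 1ℚ
  0≤u : 0ℚ ℚ.≤ u
  0≤u = ℚ.+-mono-≤ (ℚ.+-mono-≤ 0≤T 0≤T) (ℚ.<⇒≤ (ℚ.positive⁻¹ 1ℚ))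
  u<r : u ℚ.< r
  u<r = begin-strict
    T ℚ.+ T ℚ.+ 1ℚ                                            <⟨ ℚ.+-monoˡ-< 1ℚ (ℚ.+-mono-< T<g T<g) ⟩
    (r ℚ.- 1ℚ) ℚ.* ½ ℚ.+ (r ℚ.- 1ℚ) ℚ.* ½ ℚ.+ 1ℚ               ≡⟨ solve 1 (λ r → (r :- con 1ℚ) :* con ½ :+ (r :- con 1ℚ) :* con ½ :+ con 1ℚ := r) refl r ⟩
    r                                                         ∎
  case-below : 1ℚ ℚ.≤ T ℚ.* T ℚ.+ T → ¬ (r ≡ 0ℚ ⊎ r ℚ.* r ℚ.≤ + 5 / 1)
  -- The default value 0 of the approximate root is excluded, as r exceeds u ≥ 0.
  case-below _ (inj₁ r≡0) = ℚ.<-irrefl refl (ℚ.≤-<-trans 0≤u (subst (u ℚ.<_) r≡0 u<r))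
  case-below 1≤T²+T (inj₂ r²≤5) = ℚ.<-irrefl refl (begin-strict
    + 5 / 1
      ≡⟨⟩
    + 4 / 1 ℚ.* 1ℚ ℚ.+ 1ℚ
      ≤⟨ ℚ.+-monoˡ-≤ 1ℚ (ℚ.*-monoˡ-≤-nonNeg (+ 4 / 1) 1≤T²+T) ⟩
    + 4 / 1 ℚ.* (T ℚ.* T ℚ.+ T) ℚ.+ 1ℚ
      ≡⟨ solve 1 (λ t → con (+ 4 / 1) :* (t :* t :+ t) :+ con 1ℚ := (t :+ t :+ con 1ℚ) :* (t :+ t :+ con 1ℚ)) refl T ⟩
    u ℚ.* u
      ≤⟨ *-mono-≤ 0≤u 0≤u ℚ.≤-refl (ℚ.<⇒≤ u<r) ⟩
    u ℚ.* r
      <⟨ ℚ.*-monoˡ-<-pos r {{ℚ.positive (ℚ.≤-<-trans 0≤u u<r)}} u<r ⟩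
    r ℚ.* r
      ≤⟨ r²≤5 ⟩
    + 5 / 1 ∎)

-- One fixed T must serve all late terms. With T = s K + ε/2, a quarter of ε absorbs the oscillation
-- of s and another the error 1/(n+1) of the approximate root, while T stays below the Kth
-- approximation to (√5 - 1)/2.
approximations-small : ∀ w s → IsCauchy s → (∀ n → Sqrt-Facts.IsApprox (1/suc n) (norm (w n)) (s n)) →
  ∀ {ε} → 0ℚ ℚ.< ε → Eventually (λ n → s n ℚ.+ ε ℚ.≤ (√5 n ℚ.- 1ℚ) ℚ.* ½) → Small w
approximations-small w s s-cauchy approx {ε} 0<ε (N , s<g) =
  T , below-√5 K 0≤T T<g , M ℕ.⊔ ↧ₙ e , λ n n≥ → 0≤T , (begin
    norm (w n)
      ≤⟨ ℚ.<⇒≤ (IsApprox.above (approx n)) ⟩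
    (s n ℚ.+ 1/suc n) ℚ.* (s n ℚ.+ 1/suc n)
      ≤⟨ square-mono (ℚ.+-mono-≤ (0≤s n) (ℚ.<⇒≤ (0<1/suc n)))
           (s+1/suc≤T n (ℕ.m⊔n≤o⇒m≤o M (↧ₙ e) n≥) (ℕ.m⊔n≤o⇒n≤o M (↧ₙ e) n≥)) ⟩
    T ℚ.* T ∎)
  where
  open ℚ.≤-Reasoning
  open Sqrt-Facts
  h = ½ ℚ.* ε
  e = ½ ℚ.* h
  0<h = 0<* 0<½ 0<ε
  0<e = 0<* 0<½ 0<h
  M = proj₁ (s-cauchy e 0<e)
  K = M ℕ.⊔ N
  T = s K ℚ.+ h
  0≤s : ∀ n → 0ℚ ℚ.≤ s n
  0≤s n = IsApprox.nonNeg (approx n)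
  0≤T : 0ℚ ℚ.≤ T
  0≤T = ℚ.+-mono-≤ (0≤s K) (ℚ.<⇒≤ 0<h)
  T<g : T ℚ.< (√5 K ℚ.- 1ℚ) ℚ.* ½
  T<g = ℚ.<-≤-trans (ℚ.+-monoʳ-< (s K) (half<1 0<ε)) (s<g K (ℕ.m≤n⊔m M N))
  s+1/suc≤T : ∀ n → M ≤ n → ↧ₙ e ≤ n → s n ℚ.+ 1/suc n ℚ.≤ T
  s+1/suc≤T n M≤n e≤n = begin
    s n ℚ.+ 1/suc n
      ≤⟨ ℚ.+-mono-≤ (ℚ.<⇒≤ (p-q<r⇒p<q+r {s n} {s K} (ℚ.≤-<-trans (p≤∣p∣ (s n ℚ.- s K))
           (proj₂ (s-cauchy e 0<e) n K M≤n (ℕ.m≤m⊔n M N)))))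
           (1/suc-small 0<e n e≤n) ⟩
    s K ℚ.+ e ℚ.+ e
      ≡⟨ trans (ℚ.+-assoc (s K) e e) (cong (s K ℚ.+_) (half+half h)) ⟩
    T ∎

norm-small : ∀ z → ∥ z ∥ <ᴿ (√ fromℚ (+ 5 / 1) -ᴿ 1ᴿ) *ᴿ fromℚ ½ → Small (at z)
norm-small z (ε , 0<ε , z<g) = approximations-small (at z) (seq ∥ z ∥) (cauchy ∥ z ∥)
  (λ n → Sqrt-Facts.sqrtApprox-approx n (norm (at z n))) 0<ε z<g

theorem3p4 : ∀ (q : ℝ) (q′ : ℂ) → RegularPisotIn⟨1,2⟩ q → GaloisConjugate q q′ →
    (√ fromℚ (+ 5 / 1) -ᴿ 1ᴿ) *ᴿ fromℚ ½ ≤ᴿ ∥ q′ ∥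
theorem3p4 q q′ (1<q , q<2 , regular) conjugate q′<g =
  -- As `≤ᴿ` is a negation, the opposite strict inequality is at hand as `q′<g`; it makes the terms
  -- of q′ small, although p, vanishing at q, vanishes at q′ too.
  let (p , q₀ , p-avoids) = avoiding regular
  in proof p-avoids (at q′) (norm-small q′ q′<g) (conjugate-null q q′ conjugate p q₀)
  where
  null : ∀ p → IsRoot (ℤ⇒ℚ p) (fromℝ q) → NullAt p (λ n → real (seq q n))
  null p p-root = null-cong (λ n → evalAt-ℤ⇒ℚ p (real (seq q n))) (root⇒null (ℤ⇒ℚ p) (fromℝ q) p-root)
  avoiding : (∃[ p ] LimitPolynomial p × IsRoot (ℤ⇒ℚ p) (fromℝ q))
           ⊎ (Pisot q × ∃[ p ] RegularPolynomial p × IsRoot (ℤ⇒ℚ p) (fromℝ q)) →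
    ∃[ p ] NullAt p (λ n → real (seq q n)) × Avoids p
  avoiding (inj₁ (p , p-limit , p-root)) = p , null p p-root , limit-avoids p-limit
  avoiding (inj₂ (_ , p , p-regular , p-root)) =
    regular-admissible p-regular (inside-⟨1,2⟩ q 1<q q<2) (bounded-at (fromℝ q)) (null p p-root)
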